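{- Let $v\ge 3$, let $s\ge 1$ be an integer, let $\mathbf s=(s,\dots,s)$ be the regular $v$-vector, and let $m\le sv$ be a non-negative integer. If $\mathbf s=(1,1,1)$ and $m=3$, then there are exactly $7$ optimal advance bids for the $\mathbf s$-deck: $(1,1,1)$ and the permutations of $(2,1,0)$. Otherwise, the optimal advance bids for the $m$-round $\mathbf s$-game are precisely the almost regular $v$-vectors with sum $m$, i.e. the vectors $(b_1,\dots,b_v)$ of non-negative integers with $b_1+\dots+b_v=m$ and $b_i\in\{\lfloor m/v\rfloor,\lceil m/v\rceil\}$ for all $i$.
   Context: For a vector $\mathbf s=(s_1,\dots,s_v)$ of non-negative integers, the $\mathbf s$-deck consists of $s_i$ cards of Value $i$; $\Sigma(\mathbf s)=s_1+\dots+s_v$. In the $m$-round $\mathbf s$-game, the deck is shuffled uniformly at random; in each of $m$ rounds the player names a value in $\{1,\dots,v\}$ and then the top card of the remaining deck is turned face up; the player loses if in some round the turned card has the named value, and wins otherwise. An advance strategy is one where the whole sequence of $m$ bids is fixed before any card is turned; since the winning probability does not depend on the order of the bids, it is encoded by the bid vector $\mathbf b=(b_1,\dots,b_v)$ of non-negative integers with $\Sigma(\mathbf b)=m$, where $b_i$ is the number of times Value $i$ is named. Let $\Pr(\mathbf b,\mathbf s)$ be the probability that $\mathbf b$ wins. An advance bid $\mathbf b$ with $\Sigma(\mathbf b)=m$ is optimal for the $\mathbf s$-deck if $\Pr(\mathbf b',\mathbf s)\le \Pr(\mathbf b,\mathbf s)$ for every non-negative integer $v$-vector $\mathbf b'$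 with $\Sigma(\mathbf b')=m$. -}

module Defs where

open import Data.Nat using (ℕ; zero; suc; _+_; _*_; _∸_; _≡ᵇ_; _/_)
open import Data.Bool using (Bool; true; false; _∧_; not; if_then_else_)
open import Data.Fin using (Fin; _≟_)
open import Data.List using (List; []; _∷_; map; concatMap; allFin; length; filter; replicate; concat)
open import Data.Nat.ListAction using (sum)
open import Data.Bool.ListAction using (and)
open import Data.Integer using (+_)
open import Data.Rational using (ℚ; 0ℚ; _≤_)
open import Data.Rational as ℚ using ()
open import Data.Product using (_×_)
open import Relation.Nullary.Decidable using (⌊_⌋; does)
open import Relation.Binary.PropositionalEquality using (_≡_)

-- Values are Fin v (Value i+1 of the paper is (i : Fin v)).
-- Vectors (decks / bids) are functions Fin v → ℕ.

Σ : {v : ℕ} → (Fin v → ℕ) → ℕ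
Σ {v} f = sum (map f (allFin v))

words : (v n : ℕ) → List (List (Fin v))
words v zero    = [] ∷ []
words v (suc n) = concatMap (λ i → map (i ∷_) (words v n)) (allFin v)

occ : {v : ℕ} → Fin v → List (Fin v) → ℕ
occ i w = length (filter (λ x → x ≟ i) w)

isArrangement : {v : ℕ} → (Fin v → ℕ) → List (Fin v) → Bool
isArrangement {v} s w = and (map (λ i → occ i w ≡ᵇ s i) (allFin v))

bidSeq : {v : ℕ} → (Fin v → ℕ) → List (Fin v)
bidSeq {v} b = concat (map (λ i → replicate (b i) i) (allFin v))

avoids : {v : ℕ} → List (Fin v) → List (Fin v) → Bool
avoids []       _        = true
avoids (_ ∷ _)  []       = true
avoids (x ∷ xs) (y ∷ ys) = not (does (x ≟ y)) ∧ avoids xs ys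

countTrue : List Bool → ℕ
countTrue []            = 0
countTrue (true  ∷ bs)  = suc (countTrue bs)
countTrue (false ∷ bs)  = countTrue bs

-- Uniform shuffle of the deck: every arrangement (sequence of values with the
-- multiplicities s) is equally likely (each has probability ∏ s_i! / Σ(s)!).
numArrangements : {v : ℕ} → (Fin v → ℕ) → ℕ
numArrangements {v} s = countTrue (map (isArrangement s) (words v (Σ s)))

numWinning : {v : ℕ} → (Fin v → ℕ) → (Fin v → ℕ) → ℕ
numWinning {v} b s =
  countTrue (map (λ w → isArrangement s w ∧ avoids (bidSeq b) w) (words v (Σ s)))

ratio : ℕ → ℕ → ℚ
ratio a zero    = 0ℚ
ratio a (suc k) = (+ a) ℚ./ suc k

Pr : {v : ℕ} → (Fin v → ℕ) → (Fin v → ℕ) → ℚ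
Pr b s = ratio (numWinning b s) (numArrangements s)

Optimal : {v : ℕ} → (s : Fin v → ℕ) → (m : ℕ) → (b : Fin v → ℕ) → Set
Optimal {v} s m b = (Σ b ≡ m) × ((b' : Fin v → ℕ) → Σ b' ≡ m → Pr b' s ≤ Pr b s)

regular : (v s : ℕ) → Fin v → ℕ
regular v s _ = s

floorDiv : ℕ → ℕ → ℕ
floorDiv m zero    = 0
floorDiv m (suc k) = m / suc k

ceilDiv : ℕ → ℕ → ℕ
ceilDiv m zero    = 0
ceilDiv m (suc k) = (m + k) / suc k

{-# OPTIONS --safe #-}
module Submission where

-- Compare winning arrangements before and after moving one bid from i to j, where the
-- remaining bids contain at least as many i as j. The arrangements gained are those with card i
-- in the affected round, those lost have card j there. So one compares two games with the same
-- remaining bids in which one card i, respectively one card j, has already been turned. For such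
-- bids the count is monotone: having more cards i left, at the expense of cards j, never helps.
-- This property holds for an empty game and survives prepending a bid on i, a bid on another
-- value, a free round, and a pair of bids on i and j; carrying strictness along shows that the
-- move is a strict improvement if b i ≥ b j + 2 and some arrangement survives.
-- Any bid vector b reaches any balanced b* of the same sum by such moves, and the move that turns
-- an unbalanced vector into a balanced one is strict; the arrangement needed there is built from
-- cyclic shifts, and it is missing only for the deck (1,1,1) with three bids.

open import Defs
open import Algebra.Properties.CommutativeMonoid.Sum using ()
open import Data.Bool using (Bool; T; true; false; _∧_; not; if_then_else_)
open import Data.Bool.ListAction using (and)
open import Data.Bool.Properties using (∧-zeroʳ; T-≡)
open import Data.Fin using (Fin; zero; suc; _≟_)
open import Data.Fin.Properties using (all?; any?)
open import Data.Fin.Permutation using (Permutation′; _⟨$⟩ʳ_; _⟨$⟩ˡ_; _∘ₚ_; inverseʳ; transpose) renaming (id to idₚ)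
open import Data.List using (List; []; _∷_; _++_; map; concatMap; concat; allFin; tabulate; length; filter; replicate)
open import Data.List.Properties using (map-cong; map-tabulate; length-++; filter-++; map-++; map-∘; ++-identityʳ; length-tabulate; length-filter; concat-map-[_])
open import Data.List.Membership.Propositional using (_∈_)
open import Data.List.Membership.Propositional.Properties using (∈-allFin)
open import Data.List.Relation.Unary.Any using (here; there)
open import Data.List.Relation.Binary.Permutation.Propositional using (_↭_; refl; prep; swap; trans; ↭-sym; ↭-refl; ↭-trans; ↭⇒↭ₛ)
open import Data.List.Relation.Binary.Permutation.Propositional.Properties using (filter-↭; ↭-length; ∷↭∷ʳ; shifts; ++-comm)
open import Data.List.Relation.Binary.Permutation.Setoid.Properties using (Unique-resp-↭)
open import Data.List.Relation.Binary.Pointwise using (Pointwise; []; _∷_; ++⁺)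
open import Data.List.Relation.Unary.All as All using (All; []; _∷_)
open import Data.List.Relation.Unary.AllPairs using ([]; _∷_)
open import Data.List.Relation.Unary.Unique.Propositional using (Unique)
open import Data.List.Relation.Unary.Unique.Propositional.Properties using (allFin⁺)
open import Data.Nat using (ℕ; zero; suc; pred; _+_; _*_; _∸_; _/_; _%_; _≤_; _<_; z≤n; s≤s; _≡ᵇ_; NonZero; >-nonZero)
open import Data.Nat.DivMod using (m%n<n; m≡m%n+[m/n]*n; m/n*n≤m; m<n*o⇒m/o<n; /-monoˡ-≤)
open import Data.Nat.ListAction using (sum)
open import Data.Nat.Properties renaming (_≟_ to _≟ℕ_)
open import Data.Nat.Tactic.RingSolver using (solve-∀)
import Data.Integer as ℤ using (+_; +≤+)
import Data.Integer.Properties as ℤ using (*-monoʳ-≤-nonNeg; *-cancelʳ-≤-pos; drop‿+≤+)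
open import Data.Rational using () renaming (_≤_ to _≤ℚ_)
import Data.Rational as ℚ using (toℚᵘ)
import Data.Rational.Properties as ℚ using (≤-refl; toℚᵘ-cancel-≤; toℚᵘ-mono-≤; toℚᵘ-fromℚᵘ)
open import Data.Rational.Unnormalised using (mkℚᵘ; *≤*)
import Data.Rational.Unnormalised.Properties as ℚᵘ using (drop-*≤*; module ≤-Reasoning)
open import Data.Product using (_×_; ∃; _,_; proj₁; proj₂)
open import Data.Sum as Sum using (_⊎_; inj₁; inj₂)
open import Function using (_∘_; id; case_of_)
open import Function.Bundles using (_⇔_; mk⇔; Equivalence)
open import Relation.Binary.Definitions using (tri<; tri≈; tri>)
open import Relation.Nullary using (¬_; Dec; yes; no; does; contradiction; _×-dec_)
open import Relation.Nullary.Decidable using (dec-true; dec-false; decidable-stable)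
open import Relation.Binary.PropositionalEquality as ≡ using (_≡_; _≢_; _≗_; cong; cong₂; sym; subst; subst₂; setoid; module ≡-Reasoning)

open Algebra.Properties.CommutativeMonoid.Sum +-0-commutativeMonoid using (sum-cong-≗; ∑-distrib-+; ∑-comm; sum-permute; sum-replicate-zero) renaming (sum to ∑)

-- Finite sums and termwise comparison.

∑-mono-≤ : ∀ {n} {f g : Fin n → ℕ} → (∀ k → f k ≤ g k) → ∑ f ≤ ∑ g
∑-mono-≤ {zero}  f≤g = z≤n
∑-mono-≤ {suc n} f≤g = +-mono-≤ (f≤g zero) (∑-mono-≤ (f≤g ∘ suc))

∑-mono-< : ∀ {n} {f g : Fin n → ℕ} → (∀ k → f k ≤ g k) → ∀ k → f k < g k → ∑ f < ∑ g
∑-mono-< f≤g zero    lt = +-mono-<-≤ lt (∑-mono-≤ (f≤g ∘ suc))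
∑-mono-< f≤g (suc k) lt = +-mono-≤-< (f≤g zero) (∑-mono-< (f≤g ∘ suc) k lt)

∑-const : ∀ n c → ∑ {n} (λ _ → c) ≡ n * c
∑-const zero    c = ≡.refl
∑-const (suc n) c = cong (c +_) (∑-const n c)

term≤∑ : ∀ {n} (f : Fin n → ℕ) k → f k ≤ ∑ f
term≤∑ f zero    = m≤m+n _ _
term≤∑ f (suc k) = ≤-trans (term≤∑ (f ∘ suc) k) (m≤n+m _ _)

∑-zero : ∀ {n} {f : Fin n → ℕ} → (∀ k → f k ≡ 0) → ∑ f ≡ 0
∑-zero {n} f≡0 = ≡.trans (sum-cong-≗ f≡0) (sum-replicate-zero n)

Σ≡∑ : ∀ {n} (f : Fin n → ℕ) → Σ f ≡ ∑ f
Σ≡∑ {n} f = ≡.trans (cong sum (map-tabulate id f)) (go f)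
  where
  go : ∀ {n} (f : Fin n → ℕ) → sum (tabulate f) ≡ ∑ f
  go {zero}  f = ≡.refl
  go {suc n} f = cong (f zero +_) (go (f ∘ suc))

Σ-cong : ∀ {n} {f g : Fin n → ℕ} → f ≗ g → Σ f ≡ Σ g
Σ-cong {n} f≗g = cong sum (map-cong f≗g (allFin n))

but : ∀ {n} → Fin n → (Fin n → ℕ) → Fin n → ℕ
but k t y = if does (k ≟ y) then 0 else t y

∑-but : ∀ {n} (k : Fin n) (t : Fin n → ℕ) → ∑ t ≡ t k + ∑ (but k t)
∑-but zero    t = ≡.refl
∑-but (suc k) t = begin
  t zero + ∑ (t ∘ suc)                          ≡⟨ cong (t zero +_) (∑-but k (t ∘ suc)) ⟩
  t zero + (t (suc k) + ∑ (but k (t ∘ suc)))    ≡⟨ +-assoc (t zero) _ _ ⟨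
  t zero + t (suc k) + ∑ (but k (t ∘ suc))      ≡⟨ cong (_+ ∑ (but k (t ∘ suc))) (+-comm (t zero) _) ⟩
  t (suc k) + t zero + ∑ (but k (t ∘ suc))      ≡⟨ +-assoc (t (suc k)) _ _ ⟩
  t (suc k) + (t zero + ∑ (but k (t ∘ suc)))    ∎
  where open ≡-Reasoning

but-there : ∀ {n} {k y : Fin n} t → k ≢ y → but k t y ≡ t y
but-there {k = k} {y} t k≢y rewrite dec-false (k ≟ y) k≢y = ≡.refl

-- The strict part demands `0 < n` so that the relation is closed under addition: one positive term
-- on the right makes a whole sum strict, and vanishing terms do no harm.
_≼[_]_ : ℕ → Set → ℕ → Set
m ≼[ P ] n = m ≤ n × (P → 0 < n → m < n)

≼-zero : ∀ {P} → 0 ≼[ P ] 0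
≼-zero = z≤n , λ _ p → p

+-≼ : ∀ {P a b c d} → a ≼[ P ] b → c ≼[ P ] d → (a + c) ≼[ P ] (b + d)
+-≼ {P} {a} {b} {c} {d} (a≤b , a<b) (c≤d , c<d) = +-mono-≤ a≤b c≤d , strict b ≡.refl
  where
  strict : ∀ x → b ≡ x → P → 0 < b + d → a + c < b + d
  strict zero    ≡.refl p pos = +-mono-≤-< a≤b (c<d p pos)
  strict (suc x) b≡     p pos = +-mono-<-≤ (a<b p (subst (0 <_) (sym b≡) (s≤s z≤n))) c≤d

≼-weaken : ∀ {P Q m n} → (P → Q) → m ≼[ Q ] n → m ≼[ P ] n
≼-weaken P⇒Q (m≤n , m<n) = m≤n , m<n ∘ P⇒Q

≼-resp : ∀ {P m m′ n n′} → m ≡ m′ → n ≡ n′ → m ≼[ P ] n → m′ ≼[ P ] n′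
≼-resp ≡.refl ≡.refl m≼n = m≼n

∑-≼ : ∀ {P n} {f g : Fin n → ℕ} → (∀ k → f k ≼[ P ] g k) → ∑ f ≼[ P ] ∑ g
∑-≼ {n = zero}  f≼g = ≼-zero
∑-≼ {n = suc n} f≼g = +-≼ (f≼g zero) (∑-≼ (f≼g ∘ suc))

-- Words and their letter counts.

module _ {v : ℕ} where

  occ-here : ∀ (k : Fin v) xs → occ k (k ∷ xs) ≡ suc (occ k xs)
  occ-here k xs rewrite dec-true (k ≟ k) ≡.refl = ≡.refl

  occ-there : ∀ {x k : Fin v} xs → x ≢ k → occ k (x ∷ xs) ≡ occ k xs
  occ-there {x} {k} xs x≢k rewrite dec-false (x ≟ k) x≢k = ≡.refl

  occ-++ : ∀ (k : Fin v) xs ys → occ k (xs ++ ys) ≡ occ k xs + occ k ys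
  occ-++ k xs ys = ≡.trans (cong length (filter-++ (_≟ k) xs ys)) (length-++ (filter (_≟ k) xs))

  occ-↭ : ∀ (k : Fin v) {xs ys} → xs ↭ ys → occ k xs ≡ occ k ys
  occ-↭ k p = ↭-length (filter-↭ (_≟ k) p)

  extract : ∀ (x : Fin v) xs → 0 < occ x xs → ∃ λ ys → xs ↭ x ∷ ys
  extract x (y ∷ xs) pos with y ≟ x
  ... | yes ≡.refl = xs , ↭-refl
  ... | no  y≢x    with extract x xs pos
  ...   | ys , p = y ∷ ys , trans (prep y p) (swap y x ↭-refl)

  complement : ∀ (xs zs : List (Fin v)) → (∀ k → occ k xs ≤ occ k zs) → ∃ λ ys → zs ↭ xs ++ ys
  complement []       zs _  = zs , ↭-refl
  complement (x ∷ xs) zs le with extract x zs (<-≤-trans (subst (0 <_) (sym (occ-here x xs)) (s≤s z≤n)) (le x))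
  ... | zs′ , p with complement xs zs′ le′
    where
    le′ : ∀ k → occ k xs ≤ occ k zs′
    le′ k with x ≟ k | le k
    ... | yes ≡.refl | l = ≤-pred (subst (suc (occ x xs) ≤_) (≡.trans (occ-↭ x p) (occ-here x zs′)) l)
    ... | no  x≢k    | l = subst (occ k xs ≤_) (≡.trans (occ-↭ k p) (occ-there zs′ x≢k)) l
  ...   | ys , q = ys , trans p (prep x q)

  all-absent : ∀ (xs : List (Fin v)) → (∀ k → occ k xs ≡ 0) → xs ≡ []
  all-absent []       _   = ≡.refl
  all-absent (x ∷ xs) occ≡0 = contradiction (≡.trans (sym (occ-here x xs)) (occ≡0 x)) λ ()

  occ⇒↭ : ∀ (xs zs : List (Fin v)) → (∀ k → occ k xs ≡ occ k zs) → zs ↭ xs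
  occ⇒↭ xs zs eq with complement xs zs (λ k → ≤-reflexive (eq k))
  ... | ys , p = subst (zs ↭_) (++-id ys≡[]) p
    where
    ys≡[] : ys ≡ []
    ys≡[] = all-absent ys λ k → +-cancelˡ-≡ (occ k xs) (occ k ys) 0
      (≡.trans (sym (occ-++ k xs ys)) (≡.trans (sym (occ-↭ k p)) (≡.trans (sym (eq k)) (sym (+-identityʳ _)))))
    ++-id : ys ≡ [] → xs ++ ys ≡ xs
    ++-id ≡.refl = ++-identityʳ xs

and-elim : ∀ {A : Set} (p : A → Bool) xs → and (map p xs) ≡ true → ∀ {x} → x ∈ xs → p x ≡ true
and-elim p (x ∷ xs) eq x∈ with p x in px
and-elim p (x ∷ xs) eq (here ≡.refl) | true = px
and-elim p (x ∷ xs) eq (there x∈)    | true = and-elim p xs eq x∈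

and-intro : ∀ {A : Set} (p : A → Bool) xs → (∀ x → p x ≡ true) → and (map p xs) ≡ true
and-intro p []       _   = ≡.refl
and-intro p (x ∷ xs) all rewrite all x = and-intro p xs all

-- Records of turned cards and single rounds.

none : ∀ {v} → Fin v → ℕ
none _ = 0

inc : ∀ {v} → Fin v → (Fin v → ℕ) → Fin v → ℕ
inc y u k = if does (y ≟ k) then suc (u k) else u k

module _ {v : ℕ} where

  inc-here : ∀ (y : Fin v) u → inc y u y ≡ suc (u y)
  inc-here y u rewrite dec-true (y ≟ y) ≡.refl = ≡.refl

  inc-there : ∀ {y k : Fin v} u → y ≢ k → inc y u k ≡ u k
  inc-there {y} {k} u y≢k rewrite dec-false (y ≟ k) y≢k = ≡.refl

  inc-cong : ∀ (y : Fin v) {u u′} → u ≗ u′ → inc y u ≗ inc y u′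
  inc-cong y u≗u′ k with does (y ≟ k)
  ... | true  = cong suc (u≗u′ k)
  ... | false = u≗u′ k

  inc-comm : ∀ (y z : Fin v) u → inc y (inc z u) ≗ inc z (inc y u)
  inc-comm y z u k with does (y ≟ k) | does (z ≟ k)
  ... | true  | true  = ≡.refl
  ... | true  | false = ≡.refl
  ... | false | true  = ≡.refl
  ... | false | false = ≡.refl

  inc-occ : ∀ (u : Fin v → ℕ) y w k → u k + occ k (y ∷ w) ≡ inc y u k + occ k w
  inc-occ u y w k with does (y ≟ k)
  ... | true  = +-suc (u k) (occ k w)
  ... | false = ≡.refl

  -- One round: `a` marks the values that may be turned without losing, and `f` counts the
  -- continuations. Whether a card `y` is still in the deck is not checked; records only grow, so an
  -- overdrawn one fails the final test for completeness.
  draw : (Fin v → Bool) → ((Fin v → ℕ) → ℕ) → (Fin v → ℕ) → ℕ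
  draw a f u = ∑ λ y → if a y then f (inc y u) else 0

  anything : Fin v → Bool
  anything _ = true

  other-than : Fin v → Fin v → Bool
  other-than x y = not (does (x ≟ y))

  draw-cong : ∀ a (f g : (Fin v → ℕ) → ℕ) {u u′} → (∀ y → f (inc y u) ≡ g (inc y u′)) → draw a f u ≡ draw a g u′
  draw-cong a f g f≡g = sum-cong-≗ λ y → cong (if a y then_else 0) (f≡g y)

  draw-mono : ∀ a (f g : (Fin v → ℕ) → ℕ) u → (∀ w → f w ≤ g w) → draw a f u ≤ draw a g u
  draw-mono a f g u f≤g = ∑-mono-≤ go
    where
    go : ∀ y → (if a y then f (inc y u) else 0) ≤ (if a y then g (inc y u) else 0)
    go y with a y
    ... | true  = f≤g (inc y u)
    ... | false = z≤n

  draw-≥ : ∀ a (f : (Fin v → ℕ) → ℕ) u y → a y ≡ true → f (inc y u) ≤ draw a f u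
  draw-≥ a f u y ay = ≤-trans (≤-reflexive (sym (cong (if_then f (inc y u) else 0) ay)))
                              (term≤∑ (λ y → if a y then f (inc y u) else 0) y)

  -- Two rounds form a double sum over independent choices. `f` has to respect pointwise equality
  -- because the two orders of turning give records that agree only pointwise.
  draw-comm : ∀ a a′ (f : (Fin v → ℕ) → ℕ) u → (∀ {u u′} → u ≗ u′ → f u ≡ f u′) →
              draw a (draw a′ f) u ≡ draw a′ (draw a f) u
  draw-comm a a′ f u f-cong = begin
    ∑ (λ y → if a y then ∑ (λ z → if a′ z then f (inc z (inc y u)) else 0) else 0)
      ≡⟨ sum-cong-≗ (λ y → push (a y)) ⟩
    ∑ (λ y → ∑ (λ z → if a y then (if a′ z then f (inc z (inc y u)) else 0) else 0))
      ≡⟨ ∑-comm (λ y z → if a y then (if a′ z then f (inc z (inc y u)) else 0) else 0) ⟩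
    ∑ (λ z → ∑ (λ y → if a y then (if a′ z then f (inc z (inc y u)) else 0) else 0))
      ≡⟨ sum-cong-≗ (λ z → sum-cong-≗ λ y → exch (a y) (a′ z) (f-cong (inc-comm z y u))) ⟩
    ∑ (λ z → ∑ (λ y → if a′ z then (if a y then f (inc y (inc z u)) else 0) else 0))
      ≡⟨ sum-cong-≗ (λ z → push (a′ z)) ⟨
    ∑ (λ z → if a′ z then ∑ (λ y → if a y then f (inc y (inc z u)) else 0) else 0) ∎
    where
    open ≡-Reasoning
    push : ∀ c {t : Fin v → ℕ} → (if c then ∑ t else 0) ≡ ∑ (λ z → if c then t z else 0)
    push true  = ≡.refl
    push false = sym (∑-zero {v} λ _ → ≡.refl)
    exch : ∀ c d {x y : ℕ} → x ≡ y → (if c then (if d then x else 0) else 0) ≡ (if d then (if c then y else 0) else 0)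
    exch true  true  eq = eq
    exch true  false eq = ≡.refl
    exch false true  eq = ≡.refl
    exch false false eq = ≡.refl

  draw-but : ∀ x f u → draw anything f u ≡ f (inc x u) + draw (other-than x) f u
  draw-but x f u = ≡.trans (∑-but x (λ y → f (inc y u))) (cong (f (inc x u) +_) (sum-cong-≗ go))
    where
    go : ∀ y → but x (λ y → f (inc y u)) y ≡ (if other-than x y then f (inc y u) else 0)
    go y with does (x ≟ y)
    ... | true  = ≡.refl
    ... | false = ≡.refl

-- Counting winning arrangements round by round.

countTrue-++ : ∀ bs cs → countTrue (bs ++ cs) ≡ countTrue bs + countTrue cs
countTrue-++ []           cs = ≡.refl
countTrue-++ (true  ∷ bs) cs = cong suc (countTrue-++ bs cs)
countTrue-++ (false ∷ bs) cs = countTrue-++ bs cs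

count : ∀ {A : Set} → (A → Bool) → List A → ℕ
count p ws = countTrue (map p ws)

count-cong : ∀ {A : Set} {p q : A → Bool} → p ≗ q → ∀ ws → count p ws ≡ count q ws
count-cong eq ws = cong countTrue (map-cong eq ws)

count-false : ∀ {A : Set} (ws : List A) → count (λ _ → false) ws ≡ 0
count-false []       = ≡.refl
count-false (_ ∷ ws) = count-false ws

count-words : ∀ {v} n (p : List (Fin v) → Bool) →
              count p (words v (suc n)) ≡ ∑ λ y → count (λ w → p (y ∷ w)) (words v n)
count-words {v} n p = ≡.trans (go (allFin v)) (Σ≡∑ (λ y → count (λ w → p (y ∷ w)) (words v n)))
  where
  go : ∀ ys → count p (concatMap (λ y → map (y ∷_) (words v n)) ys)
            ≡ sum (map (λ y → count (λ w → p (y ∷ w)) (words v n)) ys)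
  go []       = ≡.refl
  go (y ∷ ys) = begin
    countTrue (map p (map (y ∷_) (words v n) ++ rest))
      ≡⟨ cong countTrue (map-++ p (map (y ∷_) (words v n)) rest) ⟩
    countTrue (map p (map (y ∷_) (words v n)) ++ map p rest)
      ≡⟨ countTrue-++ (map p (map (y ∷_) (words v n))) (map p rest) ⟩
    countTrue (map p (map (y ∷_) (words v n))) + count p rest
      ≡⟨ cong₂ _+_ (cong countTrue (sym (map-∘ (words v n)))) (go ys) ⟩
    _ ∎
    where
    open ≡-Reasoning
    rest = concatMap (λ y → map (y ∷_) (words v n)) ys

module Counting {v : ℕ} (s : Fin v → ℕ) where

  complete : (Fin v → ℕ) → Bool
  complete u = and (map (λ k → u k ≡ᵇ s k) (allFin v))

  complete-cong : ∀ {u u′} → u ≗ u′ → complete u ≡ complete u′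
  complete-cong u≗u′ = cong and (map-cong (λ k → cong (_≡ᵇ s k) (u≗u′ k)) (allFin v))

  complete⇒≡ : ∀ u → complete u ≡ true → ∀ k → u k ≡ s k
  complete⇒≡ u eq k = ≡ᵇ⇒≡ (u k) (s k) (subst T (sym (and-elim (λ k → u k ≡ᵇ s k) (allFin v) eq (∈-allFin k))) _)

  -- wins xs F u counts the ways to continue a game in which u records how many
  -- cards of each value were already turned: the bids xs are still to come,
  -- followed by F rounds without a bid.
  wins : List (Fin v) → ℕ → (Fin v → ℕ) → ℕ
  wins []       zero    u = if complete u then 1 else 0
  wins []       (suc F) u = draw anything (wins [] F) u
  wins (x ∷ xs) F       u = draw (other-than x) (wins xs F) u

  wins-cong : ∀ xs F {u u′} → u ≗ u′ → wins xs F u ≡ wins xs F u′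
  wins-cong []       zero    eq = cong (if_then 1 else 0) (complete-cong eq)
  wins-cong []       (suc F) eq = draw-cong anything (wins [] F) (wins [] F) λ y → wins-cong [] F (inc-cong y eq)
  wins-cong (x ∷ xs) F       eq = draw-cong (other-than x) (wins xs F) (wins xs F) λ y → wins-cong xs F (inc-cong y eq)

  -- Exchanging adjacent bids is `draw-comm`, and such exchanges generate all permutations.
  wins-↭ : ∀ {xs ys} → xs ↭ ys → ∀ F u → wins xs F u ≡ wins ys F u
  wins-↭ refl F u = ≡.refl
  wins-↭ {_ ∷ xs} {_ ∷ ys} (prep x p) F u = draw-cong (other-than x) (wins xs F) (wins ys F) λ y → wins-↭ p F (inc y u)
  wins-↭ {_ ∷ _ ∷ xs} {_ ∷ _ ∷ ys} (swap x y p) F u = ≡.trans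
    (draw-comm (other-than x) (other-than y) (wins xs F) u (wins-cong xs F))
    (draw-cong (other-than y) (wins (x ∷ xs) F) (wins (x ∷ ys) F) λ z →
      draw-cong (other-than x) (wins xs F) (wins ys F) λ t → wins-↭ p F (inc t (inc z u)))
  wins-↭ (trans p q) F u = ≡.trans (wins-↭ p F u) (wins-↭ q F u)

  -- A free round allows every card that a round with a bid allows. Free rounds stand at the end, so
  -- `x` is first moved behind the other bids.
  wins-bid : ∀ x xs F u → wins (x ∷ xs) F u ≤ wins xs (suc F) u
  wins-bid x []       F u = ∑-mono-≤ go
    where
    go : ∀ y → (if other-than x y then wins [] F (inc y u) else 0) ≤ wins [] F (inc y u)
    go y with other-than x y
    ... | true  = ≤-refl
    ... | false = z≤n
  wins-bid x (z ∷ xs) F u = ≤-trans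
    (≤-reflexive (wins-↭ (swap {xs = xs} x z refl) F u))
    (draw-mono (other-than z) (wins (x ∷ xs) F) (wins xs (suc F)) u (wins-bid x xs F))

  wins-bids : ∀ xs ys F u → wins (xs ++ ys) F u ≤ wins ys (length xs + F) u
  wins-bids []       ys F u = ≤-refl
  wins-bids (x ∷ xs) ys F u = ≤-trans
    (draw-mono (other-than x) (wins (xs ++ ys) F) (wins ys (length xs + F)) u (wins-bids xs ys F))
    (wins-bid x ys (length xs + F) u)

  finishes : (Fin v → ℕ) → List (Fin v) → Bool
  finishes u w = complete (λ k → u k + occ k w)

  -- In each round the first card of the word passes from `occ` to the record `u`, which leaves the
  -- final content unchanged. This ties the recursion to the enumeration of words.
  wins-count : ∀ xs F u → count (λ w → finishes u w ∧ avoids xs w) (words v (length xs + F)) ≡ wins xs F u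
  wins-count []       zero    u rewrite complete-cong (λ k → +-identityʳ (u k)) with complete u
  ... | true  = ≡.refl
  ... | false = ≡.refl
  wins-count []       (suc F) u = ≡.trans (count-words {v} F (λ w → finishes u w ∧ avoids [] w)) (sum-cong-≗ λ y →
    ≡.trans (count-cong (λ w → cong (_∧ true) (complete-cong (inc-occ u y w))) (words v F))
            (wins-count [] F (inc y u)))
  wins-count (x ∷ xs) F       u = ≡.trans (count-words {v} (length xs + F) (λ w → finishes u w ∧ avoids (x ∷ xs) w)) (sum-cong-≗ term)
    where
    term : ∀ y → count (λ w → finishes u (y ∷ w) ∧ (not (does (x ≟ y)) ∧ avoids xs w)) (words v (length xs + F))
               ≡ (if other-than x y then wins xs F (inc y u) else 0)
    term y with does (x ≟ y)
    ... | true  = ≡.trans (count-cong (λ w → ∧-zeroʳ (finishes u (y ∷ w))) (words v (length xs + F)))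
                          (count-false (words v (length xs + F)))
    ... | false = ≡.trans (count-cong (λ w → cong (_∧ avoids xs w) (complete-cong (inc-occ u y w))) (words v (length xs + F)))
                          (wins-count xs F (inc y u))

-- Domination

module Dominance {v : ℕ} (i j : Fin v) (i≢j : i ≢ j) where

  j≢i : j ≢ i
  j≢i = i≢j ∘ sym

  -- Both u and u′ record turned cards. The deck has as many cards i as j, so u′ leaves at least
  -- as many cards i as u leaves of either i or j: no better when the bids favour i over j.
  record Below (u′ u : Fin v → ℕ) : Set where
    field
      off   : ∀ k → i ≢ k → j ≢ k → u′ k ≡ u k
      total : u′ i + u′ j ≡ u i + u j
      ≤i    : u′ i ≤ u i
      ≤j    : u′ i ≤ u j
  open Below

  Strictly : (u′ u : Fin v → ℕ) → Set
  Strictly u′ u = u′ i < u i × u′ i < u j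

  -- Stated for arbitrary counting functions, so that each kind of round can be shown separately to
  -- preserve it.
  Dominant : ((Fin v → ℕ) → ℕ) → Set
  Dominant f = ∀ {u′ u} → Below u′ u → f u′ ≼[ Strictly u′ u ] f u

  Extensional : ((Fin v → ℕ) → ℕ) → Set
  Extensional f = ∀ {u u′} → u ≗ u′ → f u ≡ f u′

  dominant-resp : ∀ {f g} → f ≗ g → Dominant g → Dominant f
  dominant-resp f≗g D {u′} {u} B = ≼-resp (sym (f≗g u′)) (sym (f≗g u)) (D B)

  inc-off : ∀ y (u′ u : Fin v → ℕ) k → u′ k ≡ u k → inc y u′ k ≡ inc y u k
  inc-off y u′ u k eq with does (y ≟ k)
  ... | true  = cong suc eq
  ... | false = eq

  below-other : ∀ {u′ u y} → i ≢ y → j ≢ y → Below u′ u → Below (inc y u′) (inc y u)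
  below-other {u′} {u} {y} i≢y j≢y B .off k p q = inc-off y u′ u k (off B k p q)
  below-other {u′} {u} i≢y j≢y B .total
    rewrite inc-there u′ (i≢y ∘ sym) | inc-there u (i≢y ∘ sym) | inc-there u′ (j≢y ∘ sym) | inc-there u (j≢y ∘ sym) = total B
  below-other {u′} {u} i≢y j≢y B .≤i rewrite inc-there u′ (i≢y ∘ sym) | inc-there u (i≢y ∘ sym) = ≤i B
  below-other {u′} {u} i≢y j≢y B .≤j rewrite inc-there u′ (i≢y ∘ sym) | inc-there u (j≢y ∘ sym) = ≤j B

  strictly-other : ∀ u′ u {y} → i ≢ y → j ≢ y → Strictly u′ u → Strictly (inc y u′) (inc y u)
  strictly-other u′ u i≢y j≢y S
    rewrite inc-there u′ (i≢y ∘ sym) | inc-there u (i≢y ∘ sym) | inc-there u (j≢y ∘ sym) = S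

  below-j : ∀ {u′ u} → Below u′ u → Below (inc j u′) (inc j u)
  below-j {u′} {u} B .off k p q = inc-off j u′ u k (off B k p q)
  below-j {u′} {u} B .total rewrite inc-there u′ j≢i | inc-there u j≢i | inc-here j u′ | inc-here j u
    | +-suc (u′ i) (u′ j) | +-suc (u i) (u j) = cong suc (total B)
  below-j {u′} {u} B .≤i rewrite inc-there u′ j≢i | inc-there u j≢i = ≤i B
  below-j {u′} {u} B .≤j rewrite inc-there u′ j≢i | inc-here j u = m≤n⇒m≤1+n (≤j B)

  strictly-j : ∀ u′ u → Strictly u′ u → Strictly (inc j u′) (inc j u)
  strictly-j u′ u (p , q) rewrite inc-there u′ j≢i | inc-there u j≢i | inc-here j u = p , m≤n⇒m≤1+n q

  below-ij : ∀ {u′ u} → Below u′ u → Below (inc i (inc j u′)) (inc i (inc j u))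
  below-ij {u′} {u} B .off k p q = inc-off i (inc j u′) (inc j u) k (inc-off j u′ u k (off B k p q))
  below-ij {u′} {u} B .total
    rewrite inc-here i (inc j u′) | inc-here i (inc j u) | inc-there (inc j u′) i≢j | inc-there (inc j u) i≢j
    = cong suc (total (below-j B))
  below-ij {u′} {u} B .≤i rewrite inc-here i (inc j u′) | inc-here i (inc j u) = s≤s (≤i (below-j B))
  below-ij {u′} {u} B .≤j
    rewrite inc-here i (inc j u′) | inc-there (inc j u) i≢j | inc-there u′ j≢i | inc-here j u = s≤s (≤j B)

  strictly-ij : ∀ u′ u → Strictly u′ u → Strictly (inc i (inc j u′)) (inc i (inc j u))
  strictly-ij u′ u (p , q)
    rewrite inc-here i (inc j u′) | inc-here i (inc j u) | inc-there (inc j u) i≢j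
          | inc-there u′ j≢i | inc-there u j≢i | inc-here j u = s≤s p , s≤s q

  -- The left record gains a card `i` and the right one does not, so `≤i` survives only if there was
  -- a unit of slack.
  below-i-j : ∀ {u′ u} → u′ i < u i → Below u′ u → Below (inc i u′) (inc j u)
  below-i-j {u′} {u} lt B .off k p q rewrite inc-there u′ p | inc-there u q = off B k p q
  below-i-j {u′} {u} lt B .total rewrite inc-here i u′ | inc-there u′ i≢j | inc-there u j≢i | inc-here j u
    | +-suc (u i) (u j) = cong suc (total B)
  below-i-j {u′} {u} lt B .≤i rewrite inc-here i u′ | inc-there u j≢i = lt
  below-i-j {u′} {u} lt B .≤j rewrite inc-here i u′ | inc-here j u = s≤s (≤j B)

  strictly-i-j : ∀ u′ u → suc (u′ i) < u i → u′ i < u j → Strictly (inc i u′) (inc j u)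
  strictly-i-j u′ u p q rewrite inc-here i u′ | inc-there u j≢i | inc-here j u = p , s≤s q

  below-j-i : ∀ {u′ u} → Below u′ u → Below (inc j u′) (inc i u)
  below-j-i {u′} {u} B .off k p q rewrite inc-there u′ q | inc-there u p = off B k p q
  below-j-i {u′} {u} B .total rewrite inc-here i u | inc-there u i≢j | inc-there u′ j≢i | inc-here j u′
    | +-suc (u′ i) (u′ j) = cong suc (total B)
  below-j-i {u′} {u} B .≤i rewrite inc-here i u | inc-there u′ j≢i = m≤n⇒m≤1+n (≤i B)
  below-j-i {u′} {u} B .≤j rewrite inc-there u i≢j | inc-there u′ j≢i = ≤j B

  strictly-j-i : ∀ u′ u → Strictly u′ u → Strictly (inc j u′) (inc i u)
  strictly-j-i u′ u (p , q) rewrite inc-here i u | inc-there u i≢j | inc-there u′ j≢i = m≤n⇒m≤1+n p , q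

  -- `Below` is not reflexive, since `≤j` compares entry `i` with entry `j`. Where it is, turning
  -- `j` and turning `i` can be compared from one and the same record.
  below-self : ∀ u → u i ≤ u j → Below u u
  below-self u le .off k _ _ = ≡.refl
  below-self u le .total = ≡.refl
  below-self u le .≤i = ≤-refl
  below-self u le .≤j = le

  below-equal : ∀ {u′ u} → Below u′ u → u′ i ≡ u i → u′ ≗ u
  below-equal {u′} {u} B eq k with i ≟ k | j ≟ k
  ... | yes ≡.refl | _          = eq
  ... | no _       | yes ≡.refl = +-cancelˡ-≡ (u i) _ _ (≡.trans (cong (_+ u′ j) (sym eq)) (total B))
  ... | no p       | no q       = off B k p q

  others : (Fin v → Bool) → Fin v → Bool
  others a y = a y ∧ (other-than i y ∧ other-than j y)

  draw-split : ∀ a f u → draw a f u ≡ (if a i then f (inc i u) else 0) + ((if a j then f (inc j u) else 0) + draw (others a) f u)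
  draw-split a f u = ≡.trans (∑-but i t) (cong (t i +_) (≡.trans (∑-but j (but i t))
                       (cong₂ _+_ (but-there t i≢j) (sum-cong-≗ rest))))
    where
    t : Fin v → ℕ
    t y = if a y then f (inc y u) else 0
    rest : ∀ y → but j (but i t) y ≡ (if others a y then f (inc y u) else 0)
    rest y with does (j ≟ y) | does (i ≟ y) | a y
    ... | true  | true  | true  = ≡.refl
    ... | true  | true  | false = ≡.refl
    ... | true  | false | true  = ≡.refl
    ... | true  | false | false = ≡.refl
    ... | false | true  | true  = ≡.refl
    ... | false | true  | false = ≡.refl
    ... | false | false | true  = ≡.refl
    ... | false | false | false = ≡.refl

  dominant-others : ∀ a {f} → Dominant f → Dominant (draw (others a) f)
  dominant-others a {f} D {u′} {u} B = ∑-≼ term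
    where
    term : ∀ y → (if others a y then f (inc y u′) else 0) ≼[ Strictly u′ u ] (if others a y then f (inc y u) else 0)
    term y with a y | i ≟ y | j ≟ y
    ... | false | _     | _     = ≼-zero
    ... | true  | yes _ | _     = ≼-zero
    ... | true  | no _  | yes _ = ≼-zero
    ... | true  | no p  | no q  = ≼-weaken (strictly-other u′ u p q) (D (below-other p q B))

  -- The crossed pairs are compared: one more j against one more i, and vice versa.
  dominant-both : ∀ {f} → Extensional f → Dominant f → Dominant (λ u → f (inc i u) + f (inc j u))
  dominant-both {f} ext D {u′} {u} B with <-cmp (u′ i) (u i)
  ... | tri> _ _ gt = contradiction (≤i B) (<⇒≱ gt)
  -- Equal entries at `i` force the two records to agree, and then `Strictly` is impossible.
  ... | tri≈ _ eq _ = ≤-reflexive (cong₂ _+_ (ext (inc-cong i u′≗u)) (ext (inc-cong j u′≗u)))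
                    , λ S _ → contradiction eq (<⇒≢ (proj₁ S))
    where u′≗u = below-equal B eq
  ... | tri< lt _ _ = subst (_≤ f (inc i u) + f (inc j u)) (+-comm (f (inc j u′)) _)
                        (+-mono-≤ (proj₁ cross₁) (proj₁ cross₂))
                    , strict
    where
    cross₁ = D (below-j-i B)
    cross₂ = D (below-i-j lt B)
    strict : Strictly u′ u → 0 < f (inc i u) + f (inc j u) → f (inc i u′) + f (inc j u′) < f (inc i u) + f (inc j u)
    strict S@(p , q) pos with ≤-<-connex (u i) (u j)
    -- From `u` itself, turning `i` is at least as good as turning `j`. Hence a positive sum makes
    -- `f (inc i u)` positive, and the first crossing is strict.
    ... | inj₁ le = subst (_< f (inc i u) + f (inc j u)) (+-comm (f (inc j u′)) _)
        (+-mono-<-≤ (proj₂ cross₁ (strictly-j-i u′ u S) pos-i) (proj₁ cross₂))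
      where
      j≤i : f (inc j u) ≤ f (inc i u)
      j≤i = proj₁ (D (below-j-i (below-self u le)))
      pos-i : 0 < f (inc i u)
      pos-i = n≢0⇒n>0 λ z → <⇒≱ pos (≤-reflexive (cong₂ _+_ z (n≤0⇒n≡0 (subst (f (inc j u) ≤_) z j≤i))))
    -- Now `u′ i < u j < u i` leaves two units of slack, so both crossings carry strictness and
    -- either positive summand suffices.
    ... | inj₂ gt = subst (_< f (inc i u) + f (inc j u)) (+-comm (f (inc j u′)) _)
        (proj₂ (+-≼ {Strictly u′ u} (≼-weaken (strictly-j-i u′ u) cross₁) (≼-weaken (λ _ → strictly-i-j u′ u (≤-<-trans q gt) q) cross₂)) S pos)

  -- Free rounds and bids on third values allow both `i` and `j`; these two terms are compared
  -- crosswise, all others value by value.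
  dominant-draw : ∀ a {f} → a i ≡ true → a j ≡ true → Extensional f → Dominant f → Dominant (draw a f)
  dominant-draw a {f} ai aj ext D {u′} {u} B =
    ≼-resp (sym (split u′)) (sym (split u)) (+-≼ (dominant-both ext D B) (dominant-others a {f} D B))
    where
    split : ∀ u → draw a f u ≡ (f (inc i u) + f (inc j u)) + draw (others a) f u
    split u rewrite draw-split a f u | ai | aj = sym (+-assoc (f (inc i u)) _ _)

  bid-i-split : ∀ f u → draw (other-than i) f u ≡ f (inc j u) + draw (others (other-than i)) f u
  bid-i-split f u rewrite draw-split (other-than i) f u | dec-true (i ≟ i) ≡.refl | dec-false (i ≟ j) i≢j = ≡.refl

  -- Of the two values only `j` can be turned safely, and adding `j` to both records preserves
  -- `Below`.
  dominant-bid-i : ∀ {f} → Dominant f → Dominant (draw (other-than i) f)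
  dominant-bid-i {f} D {u′} {u} B =
    ≼-resp (sym (bid-i-split f u′)) (sym (bid-i-split f u))
      (+-≼ (≼-weaken (strictly-j u′ u) (D (below-j B))) (dominant-others (other-than i) {f} D B))

  -- Strictness is demanded only after `j` has been turned, when the entry of `u` at `j` has grown
  -- by one. This weaker demand holds at the start of an exchange, where `Strictly` itself fails
  -- because `u j` is 0.
  bid-i-strict : ∀ {f u′ u} → Dominant f → Below u′ u → Strictly (inc j u′) (inc j u) → 0 < f (inc j u) →
                 draw (other-than i) f u′ < draw (other-than i) f u
  bid-i-strict {f} {u′} {u} D B S pos rewrite bid-i-split f u′ | bid-i-split f u =
    +-mono-<-≤ (proj₂ (D (below-j B)) S pos) (proj₁ (dominant-others (other-than i) {f} D B))

  -- A bid on `j` alone would add `i` to both records, which can break `≤j`. Over the pair of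
  -- rounds, the terms that turn both values add both cards, the terms that turn exactly one combine
  -- into the sum treated by `dominant-both`, and the remaining terms avoid both values.
  dominant-bid-ij : ∀ {f} → Extensional f → Dominant f → Dominant (draw (other-than i) (draw (other-than j) f))
  dominant-bid-ij {f} ext D {u′} {u} B = ≼-resp (sym (split u′)) (sym (split u))
    (+-≼ (≼-weaken (strictly-ij u′ u) (D (below-ij B)))
    (+-≼ (dominant-others anything (dominant-both ext D) B)
         (dominant-others anything (dominant-others anything {f} D) B)))
    where
    U : ((Fin v → ℕ) → ℕ) → (Fin v → ℕ) → ℕ
    U = draw (others anything)
    others-i : ∀ g u → draw (others (other-than i)) g u ≡ U g u
    others-i g u = sum-cong-≗ go
      where
      go : ∀ y → (if others (other-than i) y then g (inc y u) else 0) ≡ (if others anything y then g (inc y u) else 0)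
      go y with does (i ≟ y)
      ... | true  = ≡.refl
      ... | false = ≡.refl
    others-j : ∀ g u → draw (others (other-than j)) g u ≡ U g u
    others-j g u = sum-cong-≗ go
      where
      go : ∀ y → (if others (other-than j) y then g (inc y u) else 0) ≡ (if others anything y then g (inc y u) else 0)
      go y with does (i ≟ y) | does (j ≟ y)
      ... | true  | true  = ≡.refl
      ... | false | true  = ≡.refl
      ... | true  | false = ≡.refl
      ... | false | false = ≡.refl
    bid-j : ∀ u → draw (other-than j) f u ≡ f (inc i u) + U f u
    bid-j u rewrite draw-split (other-than j) f u | dec-true (j ≟ j) ≡.refl | dec-false (j ≟ i) j≢i = cong (f (inc i u) +_) (others-j f u)
    bid-i : ∀ g u → draw (other-than i) g u ≡ g (inc j u) + U g u
    bid-i g u = ≡.trans (bid-i-split g u) (cong (g (inc j u) +_) (others-i g u))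
    U-+ : ∀ g h u → U (λ w → g w + h w) u ≡ U g u + U h u
    U-+ g h u = ≡.trans (sum-cong-≗ go) (∑-distrib-+ (λ y → if others anything y then g (inc y u) else 0) _)
      where
      go : ∀ y → (if others anything y then g (inc y u) + h (inc y u) else 0)
               ≡ (if others anything y then g (inc y u) else 0) + (if others anything y then h (inc y u) else 0)
      go y with others anything y
      ... | true  = ≡.refl
      ... | false = ≡.refl
    split : ∀ u → draw (other-than i) (draw (other-than j) f) u
                ≡ f (inc i (inc j u)) + (U (λ w → f (inc i w) + f (inc j w)) u + U (U f) u)
    split u = begin
      draw (other-than i) (draw (other-than j) f) u
        ≡⟨ bid-i (draw (other-than j) f) u ⟩
      draw (other-than j) f (inc j u) + U (draw (other-than j) f) u
        ≡⟨ cong₂ _+_ (bid-j (inc j u)) (draw-cong (others anything) (draw (other-than j) f) (λ w → f (inc i w) + U f w) {u} {u} λ y → bid-j (inc y u)) ⟩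
      (f (inc i (inc j u)) + U f (inc j u)) + U (λ w → f (inc i w) + U f w) u
        ≡⟨ cong₂ (λ x y → (f (inc i (inc j u)) + x) + y)
             (draw-cong (others anything) f (f ∘ inc j) {inc j u} {u} λ y → ext (inc-comm y j u)) (U-+ (f ∘ inc i) (U f) u) ⟩
      (f (inc i (inc j u)) + U (f ∘ inc j) u) + (U (f ∘ inc i) u + U (U f) u)
        ≡⟨ arrange (f (inc i (inc j u))) (U (f ∘ inc j) u) (U (f ∘ inc i) u) (U (U f) u) ⟩
      f (inc i (inc j u)) + ((U (f ∘ inc i) u + U (f ∘ inc j) u) + U (U f) u)
        ≡⟨ cong (λ x → f (inc i (inc j u)) + (x + U (U f) u)) (U-+ (f ∘ inc i) (f ∘ inc j) u) ⟨
      f (inc i (inc j u)) + (U (λ w → f (inc i w) + f (inc j w)) u + U (U f) u) ∎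
      where
      open ≡-Reasoning
      arrange : ∀ a b c d → (a + b) + (c + d) ≡ a + ((c + b) + d)
      arrange = solve-∀

-- The effect of replacing one bid.

module Exchange {v : ℕ} (s : Fin v → ℕ) (i j : Fin v) (i≢j : i ≢ j) (si≡sj : s i ≡ s j) where

  open Counting s
  open Dominance i j i≢j
  open Below

  -- If `u′` is complete, then `u j` is at least `u′ i`, which is `s i` and hence `s j`, which is
  -- `u′ j`. Since the totals agree, `u i` cannot exceed `u′ i`, and the records coincide. This is
  -- where the equal numbers of cards `i` and `j` enter.
  dominant-finished : Dominant (wins [] 0)
  dominant-finished {u′} {u} B with complete u′ in eq
  ... | false = z≤n , λ _ pos → pos
  ... | true  = ≤-reflexive (cong (if_then 1 else 0) (≡.trans (sym eq) (complete-cong u′≗u)))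
              , λ S _ → contradiction u′i≡ui (<⇒≢ (proj₁ S))
    where
    fin = complete⇒≡ u′ eq
    sj≤uj : s j ≤ u j
    sj≤uj = subst (_≤ u j) (≡.trans (fin i) si≡sj) (≤j B)
    ui≤u′i : u i ≤ u′ i
    ui≤u′i = +-cancelʳ-≤ (s j) (u i) (u′ i) (≤-trans (+-monoʳ-≤ (u i) sj≤uj)
               (≤-reflexive (≡.trans (sym (total B)) (cong (u′ i +_) (fin j)))))
    u′i≡ui : u′ i ≡ u i
    u′i≡ui = ≤-antisym (≤i B) ui≤u′i
    u′≗u : u′ ≗ u
    u′≗u = below-equal B u′i≡ui

  dominant-free : ∀ F → Dominant (wins [] F)
  dominant-free zero    = dominant-finished
  dominant-free (suc F) = dominant-draw anything ≡.refl ≡.refl (wins-cong [] F) (dominant-free F)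

  -- Bids on i and j are paired off, so that only bids on i remain unpaired.
  wins-dominant : ∀ xs F → occ j xs ≤ occ i xs → Dominant (wins xs F)
  wins-dominant xs F = go (length xs) xs ≤-refl
    where
    -- `n` bounds the length because pairing off recurses on a rearranged list.
    go : ∀ n xs → length xs ≤ n → occ j xs ≤ occ i xs → Dominant (wins xs F)
    go n [] _ _ = dominant-free F
    go (suc n) xs@(x ∷ rest) (s≤s len) le with occ j xs in occ-j
    -- Without bids on `j`, the head is `i` or a third value and can be stripped.
    go (suc n) xs@(x ∷ rest) (s≤s len) le | zero with i ≟ x | j ≟ x
    ... | yes ≡.refl | _ = dominant-bid-i (go n rest len (≤-trans (≤-reflexive (≡.trans (sym (occ-there rest i≢j)) occ-j)) z≤n))
    ... | no _ | yes ≡.refl = contradiction (≡.trans (sym (occ-here j rest)) occ-j) λ ()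
    ... | no i≢x | no j≢x = dominant-draw (other-than x)
            (cong not (dec-false (x ≟ i) (i≢x ∘ sym))) (cong not (dec-false (x ≟ j) (j≢x ∘ sym)))
            (wins-cong rest F) (go n rest len (≤-trans (≤-reflexive (≡.trans (sym (occ-there rest (j≢x ∘ sym))) occ-j)) z≤n))
    -- A bid on `j` comes with one on `i`; both are brought to the front.
    go (suc n) xs@(x ∷ rest) (s≤s len) le | suc c with extract i xs (<-≤-trans (s≤s z≤n) le)
    ... | ys , p with extract j ys (subst (0 <_) (≡.trans (sym occ-j) (≡.trans (occ-↭ j p) (occ-there ys i≢j))) (s≤s z≤n))
    ...   | zs , q = dominant-resp (wins-↭ r F) (dominant-bid-ij (wins-cong zs F) (go n zs len′ le′))
      where
      r : xs ↭ i ∷ j ∷ zs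
      r = ↭-trans p (prep i q)
      len′ : length zs ≤ n
      len′ = ≤-trans (n≤1+n _) (≤-trans (≤-reflexive (suc-injective (sym (↭-length r)))) len)
      le′ : occ j zs ≤ occ i zs
      le′ = ≤-pred (≤-trans (≤-reflexive (sym (≡.trans (sym occ-j) (≡.trans (occ-↭ j r) (≡.trans (occ-there (j ∷ zs) i≢j) (occ-here j zs))))))
                   (≤-trans le (≤-reflexive (≡.trans (occ-↭ i r) (≡.trans (occ-here i (j ∷ zs)) (cong suc (occ-there zs j≢i)))))))

  -- Replacing one bid on i by a bid on j gains the arrangements whose card there is i
  -- and loses those whose card there is j.
  trade : ∀ (f : (Fin v → ℕ) → ℕ) u → f (inc i u) + draw (other-than i) f u ≡ f (inc j u) + draw (other-than j) f u
  trade f u = ≡.trans (sym (draw-but i f u)) (draw-but j f u)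

  below-first : Below (inc j none) (inc i none)
  below-first = below-j-i (below-self none ≤-refl)

  -- By `trade`, the change is the difference between the continuations after turning `i` and after
  -- turning `j`, and `below-first` compares these two records.
  exchange : ∀ xs F → occ j xs ≤ occ i xs → wins (i ∷ xs) F none ≤ wins (j ∷ xs) F none
  exchange xs F le = +-cancelˡ-≤ (f (inc j none)) _ _ (≤-trans
      (+-monoˡ-≤ (draw (other-than i) f none) (proj₁ (wins-dominant xs F le below-first)))
      (≤-reflexive (trade f none)))
    where f = wins xs F

  -- Strictness arises in the round of the second bid on `i`: the hypothesis provides a winning
  -- continuation with `i` turned in the traded round and `j` in that one.
  exchange-strict : ∀ xs F → occ j xs ≤ occ i xs → 0 < wins xs F (inc j (inc i none)) →
                    wins (i ∷ i ∷ xs) F none < wins (j ∷ i ∷ xs) F none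
  exchange-strict xs F le pos = +-cancelˡ-< (f (inc j none)) _ _ (<-≤-trans
      (+-monoˡ-< (draw (other-than i) f none) gain)
      (≤-reflexive (trade f none)))
    where
    f = wins (i ∷ xs) F
    strictly : Strictly (inc j (inc j none)) (inc j (inc i none))
    strictly rewrite inc-there (inc j none) j≢i | inc-there {k = i} none j≢i | inc-there (inc i none) j≢i
                   | inc-here i none | inc-here j (inc i none) = s≤s z≤n , s≤s z≤n
    gain : f (inc j none) < f (inc i none)
    gain = bid-i-strict (wins-dominant xs F le) below-first strictly pos

-- Bid vectors as words, and derangements of multisets.

∑-inc : ∀ {n} (k : Fin n) u → ∑ (inc k u) ≡ suc (∑ u)
∑-inc k u = begin
  ∑ (inc k u)                       ≡⟨ ∑-but k (inc k u) ⟩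
  inc k u k + ∑ (but k (inc k u))   ≡⟨ cong₂ _+_ (inc-here k u) (sum-cong-≗ go) ⟩
  suc (u k + ∑ (but k u))           ≡⟨ cong suc (∑-but k u) ⟨
  suc (∑ u)                         ∎
  where
  open ≡-Reasoning
  go : ∀ y → but k (inc k u) y ≡ but k u y
  go y with does (k ≟ y)
  ... | true  = ≡.refl
  ... | false = ≡.refl

module _ {v : ℕ} where

  occ-inc : ∀ (y : Fin v) w k → occ k (y ∷ w) ≡ inc y (λ k → occ k w) k
  occ-inc y w k with does (y ≟ k)
  ... | true  = ≡.refl
  ... | false = ≡.refl

  length≡∑occ : ∀ (w : List (Fin v)) → length w ≡ ∑ λ k → occ k w
  length≡∑occ []      = sym (∑-zero {v} λ _ → ≡.refl)
  length≡∑occ (y ∷ w) = ≡.trans (cong suc (length≡∑occ w))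
                          (sym (≡.trans (sum-cong-≗ (occ-inc y w)) (∑-inc y (λ k → occ k w))))

  occ-concat : ∀ {A : Set} (k : Fin v) (g : A → List (Fin v)) xs → occ k (concat (map g xs)) ≡ sum (map (occ k ∘ g) xs)
  occ-concat k g []       = ≡.refl
  occ-concat k g (x ∷ xs) = ≡.trans (occ-++ k (g x) _) (cong (occ k (g x) +_) (occ-concat k g xs))

  occ-replicate-here : ∀ (k : Fin v) n → occ k (replicate n k) ≡ n
  occ-replicate-here k zero    = ≡.refl
  occ-replicate-here k (suc n) = ≡.trans (occ-here k (replicate n k)) (cong suc (occ-replicate-here k n))

  occ-replicate-there : ∀ {x k : Fin v} n → x ≢ k → occ k (replicate n x) ≡ 0
  occ-replicate-there         zero    x≢k = ≡.refl
  occ-replicate-there {x} (suc n) x≢k = ≡.trans (occ-there (replicate n x) x≢k) (occ-replicate-there n x≢k)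

  occ-bidSeq : ∀ (b : Fin v → ℕ) k → occ k (bidSeq b) ≡ b k
  occ-bidSeq b k = begin
    occ k (bidSeq b)       ≡⟨ occ-concat k (λ i → replicate (b i) i) (allFin v) ⟩
    Σ t                    ≡⟨ Σ≡∑ t ⟩
    ∑ t                    ≡⟨ ∑-but k t ⟩
    t k + ∑ (but k t)      ≡⟨ cong₂ _+_ (occ-replicate-here k (b k)) (∑-zero rest) ⟩
    b k + 0                ≡⟨ +-identityʳ (b k) ⟩
    b k                    ∎
    where
    open ≡-Reasoning
    t : Fin v → ℕ
    t i = occ k (replicate (b i) i)
    rest : ∀ y → but k t y ≡ 0
    rest y with k ≟ y
    ... | yes _   = ≡.refl
    ... | no  k≢y = occ-replicate-there (b y) (k≢y ∘ sym)

  length-bidSeq : ∀ (b : Fin v → ℕ) → length (bidSeq b) ≡ Σ b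
  length-bidSeq b = ≡.trans (length≡∑occ (bidSeq b)) (≡.trans (sum-cong-≗ (occ-bidSeq b)) (sym (Σ≡∑ b)))

  bidSeq-cong : ∀ {b c : Fin v → ℕ} → b ≗ c → bidSeq b ≡ bidSeq c
  bidSeq-cong b≗c = cong concat (map-cong (λ i → cong (λ n → replicate n i) (b≗c i)) (allFin v))

  bidSeq-inc : ∀ i (c : Fin v → ℕ) → bidSeq (inc i c) ↭ i ∷ bidSeq c
  bidSeq-inc i c = occ⇒↭ (i ∷ bidSeq c) (bidSeq (inc i c)) λ k →
    ≡.trans (occ-inc i (bidSeq c) k) (≡.trans (inc-cong i (occ-bidSeq c) k) (sym (occ-bidSeq (inc i c) k)))

  -- `allFin v` is the bid word of the constant vector 1.
  occ-allFin : ∀ (k : Fin v) → occ k (allFin v) ≡ 1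
  occ-allFin k = ≡.trans (cong (occ k) (sym (concat-map-[ allFin v ]))) (occ-bidSeq (λ _ → 1) k)

  -- A derangement of the multiset `d`: a word of bids and an arrangement, both of content `d`, that
  -- agree in no position.
  Deranged : (Fin v → ℕ) → Set
  Deranged d = ∃ λ xs → ∃ λ w → Pointwise _≢_ xs w × (∀ k → occ k xs ≡ d k) × (∀ k → occ k w ≡ d k)

  deranged-cong : ∀ {d d′} → d ≗ d′ → Deranged d → Deranged d′
  deranged-cong d≗d′ (xs , w , p , q , r) = xs , w , p , (λ k → ≡.trans (q k) (d≗d′ k)) , λ k → ≡.trans (r k) (d≗d′ k)

  deranged-+ : ∀ {d d′} → Deranged d → Deranged d′ → Deranged (λ k → d k + d′ k)
  deranged-+ (xs , w , p , q , r) (xs′ , w′ , p′ , q′ , r′) =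
    xs ++ xs′ , w ++ w′ , ++⁺ p p′ ,
    (λ k → ≡.trans (occ-++ k xs xs′) (cong₂ _+_ (q k) (q′ k))) ,
    (λ k → ≡.trans (occ-++ k w w′) (cong₂ _+_ (r k) (r′ k)))

  deranged-* : ∀ n {d} → Deranged d → Deranged (λ k → n * d k)
  deranged-* zero    D = [] , [] , [] , (λ _ → ≡.refl) , λ _ → ≡.refl
  deranged-* (suc n) D = deranged-+ D (deranged-* n D)

  -- `z` stands for the letter that a cyclic shift carries from the front to the end; without
  -- repetitions, every letter is followed by a different one.
  rotation-≢ : ∀ {z : Fin v} y ys → Unique (y ∷ ys) → All (_≢ z) (y ∷ ys) → Pointwise _≢_ (y ∷ ys) (ys ++ z ∷ [])
  rotation-≢ y []        _                      (y≢z ∷ _)   = y≢z ∷ []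
  rotation-≢ y (y′ ∷ ys) ((y≢y′ ∷ _) ∷ unique)  (_ ∷ ys≢z)  = y≢y′ ∷ rotation-≢ y′ ys unique ys≢z

  deranged-unique : ∀ x y ys → Unique (x ∷ y ∷ ys) → Deranged (λ k → occ k (x ∷ y ∷ ys))
  deranged-unique x y ys ((x≢y ∷ x≢ys) ∷ unique) =
    x ∷ y ∷ ys , y ∷ ys ++ x ∷ [] ,
    x≢y ∷ rotation-≢ y ys unique (All.map (_∘ sym) (x≢y ∷ x≢ys)) ,
    (λ _ → ≡.refl) , λ k → occ-↭ k (↭-sym (∷↭∷ʳ x (y ∷ ys)))

  remaining : ∀ (i j : Fin v) → i ≢ j → ∃ λ l → allFin v ↭ i ∷ j ∷ l
  remaining i j i≢j = complement (i ∷ j ∷ []) (allFin v) λ k → ≤-trans (at-most-one k) (≤-reflexive (sym (occ-allFin k)))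
    where
    at-most-one : ∀ k → occ k (i ∷ j ∷ []) ≤ 1
    at-most-one k = case i ≟ k of λ where
      (yes ≡.refl) → ≤-reflexive (≡.trans (occ-here i (j ∷ [])) (cong suc (occ-there [] (i≢j ∘ sym))))
      (no i≢k)     → ≤-trans (≤-reflexive (occ-there (j ∷ []) i≢k)) (length-filter (_≟ k) (j ∷ []))

  both : (i j : Fin v) → Fin v → ℕ
  both i j = inc j (inc i none)

  both-remaining : ∀ {i j : Fin v} {l} → allFin v ↭ i ∷ j ∷ l → ∀ k → both i j k + occ k l ≡ 1
  both-remaining {i} {j} {l} p k = begin
    both i j k + occ k l                ≡⟨ inc-occ (inc i none) j l k ⟨
    inc i none k + occ k (j ∷ l)        ≡⟨ inc-occ none i (j ∷ l) k ⟨
    occ k (i ∷ j ∷ l)                   ≡⟨ occ-↭ k p ⟨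
    occ k (allFin v)                    ≡⟨ occ-allFin k ⟩
    1                                   ∎
    where open ≡-Reasoning

  -- If at least two values remain besides `i` and `j`, these are shifted cyclically, and so is each
  -- of the `t` full copies of all values. A single further value cannot be shifted by itself and
  -- has to be joined with a full copy, which exists only for positive `t`.
  deranged-without-both : ∀ (i j : Fin v) → i ≢ j → 3 ≤ v → ∀ t → ¬ (v ≡ 3 × t ≡ 0) →
                          ∃ λ d → Deranged d × (∀ k → both i j k + d k ≡ suc t)
  deranged-without-both i j i≢j v≥3 t ¬exc with remaining i j i≢j
  ... | l , p = go l p t ¬exc
    where
    unique : ∀ {l} → allFin v ↭ i ∷ j ∷ l → Unique (i ∷ j ∷ l)
    unique p = Unique-resp-↭ (setoid (Fin v)) (↭⇒↭ₛ p) (allFin⁺ v)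
    one-each : ∀ {l} → allFin v ↭ i ∷ j ∷ l → Deranged (λ _ → 1)
    one-each {l} p = deranged-cong (λ k → ≡.trans (sym (occ-↭ k p)) (occ-allFin k)) (deranged-unique i j l (unique p))
    size : ∀ {l} → allFin v ↭ i ∷ j ∷ l → v ≡ 2 + length l
    size p = ≡.trans (sym (length-tabulate id)) (↭-length p)
    go : ∀ l → allFin v ↭ i ∷ j ∷ l → ∀ t → ¬ (v ≡ 3 × t ≡ 0) → ∃ λ d → Deranged d × (∀ k → both i j k + d k ≡ suc t)
    go [] p _ _ = contradiction v≥3 (<⇒≱ (subst (_< 3) (sym (size p)) ≤-refl))
    go (a ∷ []) p zero    ¬exc = contradiction (size p , ≡.refl) ¬exc
    -- The leftover `a` and one full copy form a block in which the two letters `a` face `i` and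
    -- `j`, and conversely.
    go (a ∷ []) p (suc t) _    = _ , deranged-+ block (deranged-* t (one-each p)) , λ k → begin
        both i j k + (occ k (a ∷ a ∷ i ∷ j ∷ []) + t * 1)
          ≡⟨ cong₂ (λ x y → both i j k + (x + y)) (occ-++ k (a ∷ []) (a ∷ i ∷ j ∷ [])) (*-identityʳ t) ⟩
        both i j k + ((occ k (a ∷ []) + occ k (a ∷ i ∷ j ∷ [])) + t)
          ≡⟨ cong (λ x → both i j k + ((occ k (a ∷ []) + x) + t)) (occ-↭ k (↭-sym (∷↭∷ʳ a (i ∷ j ∷ [])))) ⟨
        both i j k + ((occ k (a ∷ []) + occ k (i ∷ j ∷ a ∷ [])) + t)
          ≡⟨ cong (λ x → both i j k + ((occ k (a ∷ []) + x) + t)) (≡.trans (sym (occ-↭ k p)) (occ-allFin k)) ⟩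
        both i j k + ((occ k (a ∷ []) + 1) + t)
          ≡⟨ arrange (both i j k) (occ k (a ∷ [])) t ⟩
        (both i j k + occ k (a ∷ [])) + suc t
          ≡⟨ cong (_+ suc t) (both-remaining p k) ⟩
        suc (suc t) ∎
      where
      open ≡-Reasoning
      arrange : ∀ x y z → x + ((y + 1) + z) ≡ (x + y) + suc z
      arrange = solve-∀
      block : Deranged (λ k → occ k (a ∷ a ∷ i ∷ j ∷ []))
      block with unique p
      ... | (_ ∷ i≢a ∷ []) ∷ (j≢a ∷ []) ∷ _ =
        a ∷ a ∷ i ∷ j ∷ [] , i ∷ j ∷ a ∷ a ∷ [] ,
        (i≢a ∘ sym) ∷ (j≢a ∘ sym) ∷ i≢a ∷ j≢a ∷ [] , (λ _ → ≡.refl) ,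
        λ k → occ-↭ k (shifts (i ∷ j ∷ []) (a ∷ a ∷ []))
    go (a ∷ a′ ∷ l) p t _ with unique p
    ... | _ ∷ _ ∷ u = _ , deranged-+ (deranged-unique a a′ l u) (deranged-* t (one-each p)) , λ k → begin
        both i j k + (occ k (a ∷ a′ ∷ l) + t * 1)   ≡⟨ +-assoc (both i j k) _ _ ⟨
        both i j k + occ k (a ∷ a′ ∷ l) + t * 1     ≡⟨ cong₂ _+_ (both-remaining p k) (*-identityʳ t) ⟩
        suc t                                       ∎
      where open ≡-Reasoning

-- Existence of winning arrangements.

module Positivity {v : ℕ} (s : Fin v → ℕ) where

  open Counting s

  wins-word : ∀ {xs w} u → Pointwise _≢_ xs w → (∀ k → u k + occ k w ≡ s k) → 0 < wins xs 0 u
  wins-word u [] fin = ≤-reflexive (sym (cong (if_then 1 else 0) (and-intro _ (allFin v) λ k →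
    Equivalence.to T-≡ (≡⇒≡ᵇ (u k) (s k) (≡.trans (sym (+-identityʳ (u k))) (fin k))))))
  wins-word {x ∷ xs} {y ∷ w} u (x≢y ∷ p) fin =
    ≤-trans (wins-word (inc y u) p λ k → ≡.trans (sym (inc-occ u y w k)) (fin k))
            (draw-≥ (other-than x) (wins xs 0) u y (cong not (dec-false (x ≟ y) x≢y)))

  -- The bids of the deranged word beyond those of `e` are dropped and become free rounds; the
  -- condition on sums says that there are exactly `F` of them.
  wins-deranged : ∀ {d} u e F → Deranged d → (∀ k → u k + d k ≡ s k) → (∀ k → e k ≤ d k) →
                  F + ∑ e ≡ ∑ d → 0 < wins (bidSeq e) F u
  wins-deranged {d} u e F (xs , w , p , q , r) fin e≤d size
    with complement (bidSeq e) xs (λ k → ≤-trans (≤-reflexive (occ-bidSeq e k)) (≤-trans (e≤d k) (≤-reflexive (sym (q k)))))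
  ... | ys , xs↭ = subst (λ F → 0 < wins (bidSeq e) F u) len
        (≤-trans (wins-word u p (λ k → ≡.trans (cong (u k +_) (r k)) (fin k)))
        (≤-trans (≤-reflexive (wins-↭ (↭-trans xs↭ (++-comm (bidSeq e) ys)) 0 u))
                 (wins-bids ys (bidSeq e) 0 u)))
    where
    open ≡-Reasoning
    len : length ys + 0 ≡ F
    len = ≡.trans (+-identityʳ _) (+-cancelˡ-≡ (∑ e) _ _ (begin
      ∑ e + length ys                   ≡⟨ cong (_+ length ys) (≡.trans (length-bidSeq e) (Σ≡∑ e)) ⟨
      length (bidSeq e) + length ys     ≡⟨ length-++ (bidSeq e) ⟨
      length (bidSeq e ++ ys)           ≡⟨ ↭-length xs↭ ⟨
      length xs                         ≡⟨ length≡∑occ xs ⟩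
      ∑ (λ k → occ k xs)                ≡⟨ sum-cong-≗ q ⟩
      ∑ d                               ≡⟨ size ⟨
      F + ∑ e                           ≡⟨ +-comm F (∑ e) ⟩
      ∑ e + F                           ∎))

-- Balanced vectors, floors and ceilings.

Balanced : ∀ {v} → (Fin v → ℕ) → Set
Balanced b = ∀ k l → b k ≤ suc (b l)

balanced? : ∀ {v} (b : Fin v → ℕ) → Dec (Balanced b)
balanced? b = all? λ k → all? λ l → b k ≤? suc (b l)

balanced-cong : ∀ {v} {b c : Fin v → ℕ} → b ≗ c → Balanced b → Balanced c
balanced-cong b≗c bal k l = subst₂ (λ x y → x ≤ suc y) (b≗c k) (b≗c l) (bal k l)

-- An entry above `s` would force every entry to be at least `s`, and the sum would exceed `v * s`.
balanced-≤ : ∀ {v} {b : Fin v → ℕ} s → Balanced b → ∑ b ≤ v * s → ∀ k → b k ≤ s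
balanced-≤ {v} {b} s bal ∑≤ k = ≮⇒≥ λ s<bk →
  <⇒≱ (subst (_< ∑ b) (∑-const v s) (∑-mono-< (λ l → ≤-pred (≤-trans s<bk (bal k l))) k s<bk)) ∑≤

balanced-≥ : ∀ {v} {b : Fin v → ℕ} s → Balanced b → v * s ≤ ∑ b → ∀ k → s ≤ b k
balanced-≥ {v} {b} s bal ≤∑ k = ≮⇒≥ λ bk<s →
  <⇒≱ (subst (∑ b <_) (∑-const v s) (∑-mono-< (λ l → ≤-trans (bal l k) bk<s) k bk<s)) ≤∑

-- Every entry is the quotient, and the first `m % v` entries get one more.
balanced-exists : ∀ v m → .{{_ : NonZero v}} → ∃ λ (b : Fin v → ℕ) → ∑ b ≡ m × Balanced b
balanced-exists v m with indicator v (m % v) (<⇒≤ (m%n<n m v))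
  where
  indicator : ∀ n r → r ≤ n → ∃ λ (e : Fin n → ℕ) → ∑ e ≡ r × (∀ k → e k ≤ 1)
  indicator n       zero    _         = none , ∑-zero {n} (λ _ → ≡.refl) , λ _ → z≤n
  indicator (suc n) (suc r) (s≤s r≤n) with indicator n r r≤n
  ... | e , ∑e , e≤1 = (λ { zero → 1 ; (suc k) → e k }) , cong suc ∑e , λ { zero → ≤-refl ; (suc k) → e≤1 k }
... | e , ∑e , e≤1 = (λ k → m / v + e k) , total , λ k l →
      ≤-trans (+-monoʳ-≤ (m / v) (≤-trans (e≤1 k) (s≤s z≤n))) (≤-reflexive (+-suc (m / v) (e l)))
  where
  open ≡-Reasoning
  total : ∑ (λ k → m / v + e k) ≡ m
  total = begin
    ∑ (λ k → m / v + e k)          ≡⟨ ∑-distrib-+ (λ _ → m / v) e ⟩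
    ∑ {v} (λ _ → m / v) + ∑ e      ≡⟨ cong₂ _+_ (∑-const v (m / v)) ∑e ⟩
    v * (m / v) + m % v            ≡⟨ +-comm _ (m % v) ⟩
    m % v + v * (m / v)            ≡⟨ cong (m % v +_) (*-comm v (m / v)) ⟩
    m % v + m / v * v              ≡⟨ m≡m%n+[m/n]*n m v ⟨
    m                              ∎

module Rounding (n m : ℕ) where

  v = suc n

  floor≤ceil : m / v ≤ (m + n) / v
  floor≤ceil = /-monoˡ-≤ v (m≤m+n m n)

  ceil≤1+floor : (m + n) / v ≤ suc (m / v)
  ceil≤1+floor = ≤-pred (m<n*o⇒m/o<n (begin-strict
    m + n                           ≡⟨ cong (_+ n) (m≡m%n+[m/n]*n m v) ⟩
    m % v + m / v * v + n           <⟨ +-mono-<-≤ (+-monoˡ-< (m / v * v) (m%n<n m v)) (n≤1+n n) ⟩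
    v + m / v * v + v               ≡⟨ +-comm (v + m / v * v) v ⟩
    suc (suc (m / v)) * v           ∎))
    where open ≤-Reasoning

  m≤v*ceil : m ≤ v * ((m + n) / v)
  m≤v*ceil = +-cancelʳ-≤ n m _ (begin
    m + n                                 ≡⟨ m≡m%n+[m/n]*n (m + n) v ⟩
    (m + n) % v + (m + n) / v * v         ≤⟨ +-monoˡ-≤ _ (≤-pred (m%n<n (m + n) v)) ⟩
    n + (m + n) / v * v                   ≡⟨ +-comm n _ ⟩
    (m + n) / v * v + n                   ≡⟨ cong (_+ n) (*-comm ((m + n) / v) v) ⟩
    v * ((m + n) / v) + n                 ∎)
    where open ≤-Reasoning

  -- Comparing `m` with `v` times the floor and `v` times the ceiling bounds each entry by these
  -- two, which differ by at most one.
  balanced⇒rounded : ∀ {b : Fin v → ℕ} → ∑ b ≡ m → Balanced b → ∀ k → b k ≡ m / v ⊎ b k ≡ (m + n) / v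
  balanced⇒rounded {b} ∑b bal k with m≤n⇒m<n∨m≡n (balanced-≥ (m / v) bal (subst (v * (m / v) ≤_) (sym ∑b) (subst (_≤ m) (*-comm (m / v) v) (m/n*n≤m m v))) k)
  ... | inj₂ eq = inj₁ (sym eq)
  ... | inj₁ lt = inj₂ (≤-antisym (balanced-≤ _ bal (subst (_≤ v * ((m + n) / v)) (sym ∑b) m≤v*ceil) k) (≤-trans ceil≤1+floor lt))

  rounded⇒balanced : ∀ {b : Fin v → ℕ} → (∀ k → b k ≡ m / v ⊎ b k ≡ (m + n) / v) → Balanced b
  rounded⇒balanced {b} rnd k l = ≤-trans (upper k) (s≤s (lower l))
    where
    upper : ∀ k → b k ≤ suc (m / v)
    upper k with rnd k
    ... | inj₁ eq = ≤-trans (≤-reflexive eq) (n≤1+n _)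
    ... | inj₂ eq = ≤-trans (≤-reflexive eq) ceil≤1+floor
    lower : ∀ k → m / v ≤ b k
    lower k with rnd k
    ... | inj₁ eq = ≤-reflexive (sym eq)
    ... | inj₂ eq = ≤-trans floor≤ceil (≤-reflexive (sym eq))

-- Moving one bid.

dec : ∀ {v} → Fin v → (Fin v → ℕ) → Fin v → ℕ
dec i b k = if does (i ≟ k) then pred (b k) else b k

module _ {v : ℕ} where

  dec-here : ∀ (i : Fin v) b → dec i b i ≡ pred (b i)
  dec-here i b rewrite dec-true (i ≟ i) ≡.refl = ≡.refl

  dec-there : ∀ {i k : Fin v} b → i ≢ k → dec i b k ≡ b k
  dec-there {i} {k} b i≢k rewrite dec-false (i ≟ k) i≢k = ≡.refl

  inc-dec : ∀ {i : Fin v} {b} → 0 < b i → b ≗ inc i (dec i b)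
  inc-dec {i} {b} pos k with i ≟ k
  ... | yes ≡.refl = sym (suc-pred (b i) {{>-nonZero pos}})
  ... | no  _      = ≡.refl

  both-+ : ∀ (i j : Fin v) e k → inc j (inc i e) k ≡ both i j k + e k
  both-+ i j e k with does (i ≟ k) | does (j ≟ k)
  ... | true  | true  = ≡.refl
  ... | true  | false = ≡.refl
  ... | false | true  = ≡.refl
  ... | false | false = ≡.refl

  -- If c i ≡ c j, the two vectors differ only by exchanging the entries i and j.
  balanced-swap : ∀ {i j : Fin v} {c} → i ≢ j → c i ≡ c j → Balanced (inc j c) → Balanced (inc i c)
  balanced-swap {i} {j} {c} i≢j ci≡cj bal k l with match k | match l
    where
    match : ∀ k → ∃ λ k′ → inc j c k′ ≡ inc i c k
    match k = case ((i ≟ k) , (j ≟ k)) of λ where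
      (yes ≡.refl , _)        → j , ≡.trans (inc-here j c) (≡.trans (cong suc (sym ci≡cj)) (sym (inc-here i c)))
      (no _ , yes ≡.refl)     → i , ≡.trans (inc-there c (i≢j ∘ sym)) (≡.trans ci≡cj (sym (inc-there c i≢j)))
      (no i≢k , no j≢k)       → k , ≡.trans (inc-there c j≢k) (sym (inc-there c i≢k))
  ... | k′ , p | l′ , q = subst₂ (λ x y → x ≤ suc y) p q (bal k′ l′)

-- Optimal bids for a regular deck.

module Game (v t m : ℕ) (v≥3 : 3 ≤ v) (m≤ : m ≤ suc t * v) where

  s F : ℕ
  s = suc t
  -- After the bids, free rounds turn the rest of the deck, so that whole arrangements are counted.
  F = v * s ∸ m

  deck : Fin v → ℕ
  deck = regular v s

  open Counting deck
  open Positivity deck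

  m≤vs : m ≤ v * s
  m≤vs = subst (m ≤_) (*-comm s v) m≤

  size : F + m ≡ v * s
  size = m∸n+n≡m m≤vs

  winning : (Fin v → ℕ) → ℕ
  winning b = wins (bidSeq b) F none

  numWinning≡winning : ∀ b → ∑ b ≡ m → numWinning b deck ≡ winning b
  numWinning≡winning b ∑b = ≡.trans
    (cong (λ n → countTrue (map (λ w → isArrangement deck w ∧ avoids (bidSeq b) w) (words v n))) total)
    (wins-count (bidSeq b) F none)
    where
    open ≡-Reasoning
    total : Σ deck ≡ length (bidSeq b) + F
    total = begin
      Σ deck                       ≡⟨ Σ≡∑ deck ⟩
      ∑ deck                       ≡⟨ ∑-const v s ⟩
      v * s                        ≡⟨ size ⟨
      F + m                        ≡⟨ +-comm F m ⟩
      m + F                        ≡⟨ cong (_+ F) (≡.trans (length-bidSeq b) (≡.trans (Σ≡∑ b) ∑b)) ⟨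
      length (bidSeq b) + F        ∎

  winning-cong : ∀ {b c} → b ≗ c → winning b ≡ winning c
  winning-cong b≗c = cong (λ xs → wins xs F none) (bidSeq-cong b≗c)

  winning-inc : ∀ i c → winning (inc i c) ≡ wins (i ∷ bidSeq c) F none
  winning-inc i c = wins-↭ (bidSeq-inc i c) F none

  winning-inc² : ∀ i j c → winning (inc j (inc i c)) ≡ wins (j ∷ i ∷ bidSeq c) F none
  winning-inc² i j c = ≡.trans (winning-inc j (inc i c)) (wins-↭ (prep j (bidSeq-inc i c)) F none)

  improve : ∀ {i j c} → i ≢ j → c j ≤ c i → winning (inc i c) ≤ winning (inc j c)
  improve {i} {j} {c} i≢j le = subst₂ _≤_ (sym (winning-inc i c)) (sym (winning-inc j c))
    (Exchange.exchange deck i j i≢j ≡.refl (bidSeq c) F (subst₂ _≤_ (sym (occ-bidSeq c j)) (sym (occ-bidSeq c i)) le))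

  Exceptional : Set
  Exceptional = v ≡ 3 × s ≡ 1 × m ≡ 3

  -- Taking out one card `i` and one card `j` leaves a multiset with a derangement, except for three
  -- distinct cards. The full bid is balanced, so it names no value more than `s` times, and `e`
  -- fits into that multiset.
  positive : ¬ Exceptional → ∀ {i j e} → i ≢ j → ∑ (inc j (inc i e)) ≡ m → Balanced (inc j (inc i e)) →
             0 < wins (bidSeq e) F (both i j)
  positive ¬exc {i} {j} {e} i≢j ∑b bal = case (v ≟ℕ 3) ×-dec (t ≟ℕ 0) of λ where
      (yes (v≡3 , t≡0)) → small v≡3 t≡0
      (no ¬small)       → general ¬small
    where
    2+∑e : 2 + ∑ e ≡ m
    2+∑e = ≡.trans (sym (≡.trans (∑-inc j (inc i e)) (cong suc (∑-inc i e)))) ∑b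
    general : ¬ (v ≡ 3 × t ≡ 0) → 0 < wins (bidSeq e) F (both i j)
    general ¬small with deranged-without-both i j i≢j v≥3 t ¬small
    ... | d , D , fin = wins-deranged (both i j) e F D fin
        (λ k → +-cancelˡ-≤ (both i j k) _ _ (subst₂ _≤_ (both-+ i j e k) (sym (fin k))
                 (balanced-≤ s bal (subst (_≤ v * s) (sym ∑b) m≤vs) k)))
        (+-cancelˡ-≡ 2 _ _ (begin
          2 + (F + ∑ e)           ≡⟨ arrange F (∑ e) ⟩
          F + (2 + ∑ e)           ≡⟨ cong (F +_) 2+∑e ⟩
          F + m                   ≡⟨ size ⟩
          v * s                   ≡⟨ ∑-const v s ⟨
          ∑ deck                  ≡⟨ sum-cong-≗ fin ⟨
          ∑ (λ k → both i j k + d k)     ≡⟨ ∑-distrib-+ (both i j) d ⟩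
          ∑ (both i j) + ∑ d      ≡⟨ cong (_+ ∑ d) (≡.trans (∑-inc j (inc i none)) (cong suc (≡.trans (∑-inc i none) (cong suc (∑-zero {v} λ _ → ≡.refl))))) ⟩
          2 + ∑ d                 ∎))
      where
      open ≡-Reasoning
      arrange : ∀ x y → 2 + (x + y) ≡ x + (2 + y)
      arrange = solve-∀
    -- Here m ≤ 2, so e vanishes and the single remaining card meets no bid.
    small : v ≡ 3 → t ≡ 0 → 0 < wins (bidSeq e) F (both i j)
    small v≡3 t≡0 with remaining i j i≢j
    ... | l , p = subst₂ (λ xs n → 0 < wins xs n (both i j)) (sym no-bids) (sym F≡1) (free l p)
      where
      vs≡3 : v * s ≡ 3
      vs≡3 = ≡.trans (cong₂ (λ x y → x * suc y) v≡3 t≡0) ≡.refl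
      m<3 : m < 3
      m<3 = ≤∧≢⇒< (subst (m ≤_) vs≡3 m≤vs) λ m≡3 → ¬exc (v≡3 , cong suc t≡0 , m≡3)
      ∑e≡0 : ∑ e ≡ 0
      ∑e≡0 = n≤0⇒n≡0 (≤-pred (≤-pred (≤-pred (subst (λ x → suc x ≤ 3) (sym 2+∑e) m<3))))
      no-bids : bidSeq e ≡ []
      no-bids = all-absent (bidSeq e) λ k → ≡.trans (occ-bidSeq e k) (n≤0⇒n≡0 (≤-trans (term≤∑ e k) (≤-reflexive ∑e≡0)))
      F≡1 : F ≡ 1
      F≡1 = cong₂ _∸_ vs≡3 (≡.trans (sym 2+∑e) (cong (2 +_) ∑e≡0))
      free : ∀ l → allFin v ↭ i ∷ j ∷ l → 0 < wins [] 1 (both i j)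
      free (a ∷ []) p = ≤-trans
        (wins-word (inc a (both i j)) [] λ k → ≡.trans (sym (inc-occ (both i j) a [] k)) (≡.trans (both-remaining p k) (cong suc (sym t≡0))))
        (draw-≥ anything (wins [] 0) (both i j) a ≡.refl)
      free [] p = contradiction (≡.trans (sym (↭-length p)) (≡.trans (length-tabulate id) v≡3)) λ ()
      free (_ ∷ _ ∷ _) p = contradiction (≡.trans (sym (↭-length p)) (≡.trans (length-tabulate id) v≡3)) λ ()

  -- Since `c j < c i`, a second bid on `i` can be split off, and the rest `e` still has at least as
  -- many bids on `i` as on `j`. The balanced result of the move supplies the surviving arrangement.
  improve-strict : ¬ Exceptional → ∀ {i j c} → i ≢ j → c j < c i → ∑ (inc j c) ≡ m → Balanced (inc j c) →
                   winning (inc i c) < winning (inc j c)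
  improve-strict ¬exc {i} {j} {c} i≢j lt ∑b bal = subst₂ _<_
      (≡.trans (sym (winning-inc² i i e)) (winning-cong (inc-cong i (sym ∘ c≗))))
      (≡.trans (sym (winning-inc² i j e)) (winning-cong (inc-cong j (sym ∘ c≗))))
      (Exchange.exchange-strict deck i j i≢j ≡.refl (bidSeq e) F
        (subst₂ _≤_ (sym (≡.trans (occ-bidSeq e j) (dec-there c i≢j))) (sym (≡.trans (occ-bidSeq e i) (dec-here i c))) (<⇒≤pred lt))
        (positive ¬exc i≢j (≡.trans (sum-cong-≗ (inc-cong j (sym ∘ c≗))) ∑b) (balanced-cong (inc-cong j c≗) bal)))
    where
    e = dec i c
    c≗ : c ≗ inc i e
    c≗ = inc-dec (≤-trans (s≤s z≤n) lt)

  module Target (b* : Fin v → ℕ) (∑b* : ∑ b* ≡ m) (bal* : Balanced b*) where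

    -- Counting the excess is enough: with equal sums, no excess means no deficit either.
    distance : (Fin v → ℕ) → ℕ
    distance b = ∑ λ k → b k ∸ b* k

    Optimum : (Fin v → ℕ) → Set
    Optimum b = winning b ≤ winning b* × (¬ Exceptional → ¬ Balanced b → winning b < winning b*)

    -- A bid is moved from a value with excess to one with deficit. This lowers `distance`, so `b*`
    -- is reached by finitely many moves, none of which hurts.
    descend : ∀ n b → distance b < n → ∑ b ≡ m → Optimum b
    descend (suc n) b (s≤s dist) ∑b with any? (λ k → b* k <? b k)
    ... | no none-above = ≤-reflexive (winning-cong b≗b*) , λ _ ¬bal → contradiction (balanced-cong (sym ∘ b≗b*) bal*) ¬bal
      where
      b≤b* : ∀ k → b k ≤ b* k
      b≤b* k = ≮⇒≥ λ lt → none-above (k , lt)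
      b≗b* : b ≗ b*
      b≗b* k with m≤n⇒m<n∨m≡n (b≤b* k)
      ... | inj₁ lt = contradiction (≡.trans ∑b (sym ∑b*)) (<⇒≢ (∑-mono-< b≤b* k lt))
      ... | inj₂ eq = eq
    ... | yes (i , bi>) with any? (λ k → b k <? b* k)
    ...   | no none-below = contradiction (≡.trans ∑b* (sym ∑b)) (<⇒≢ (∑-mono-< (λ k → ≮⇒≥ λ lt → none-below (k , lt)) i bi>))
    ...   | yes (j , bj<) = step (descend n b₁ closer ∑b₁)
      where
      c b₁ : Fin v → ℕ
      c  = dec i b
      b₁ = inc j c
      i≢j : i ≢ j
      i≢j ≡.refl = <-asym bi> bj<
      b≗ : b ≗ inc i c
      b≗ = inc-dec (≤-trans (s≤s z≤n) bi>)
      cj≡bj : c j ≡ b j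
      cj≡bj = dec-there b i≢j
      cj≤ci : c j ≤ c i
      -- Balance of `b*` gives `b j < b* j ≤ suc (b* i) ≤ b i`.
      cj≤ci = subst₂ _≤_ (sym cj≡bj) (sym (dec-here i b))
                (<⇒≤pred (<-≤-trans bj< (≤-trans (bal* j i) bi>)))
      ∑b₁ : ∑ b₁ ≡ m
      ∑b₁ = ≡.trans (∑-inc j c) (≡.trans (sym (∑-inc i c)) (≡.trans (sum-cong-≗ (sym ∘ b≗)) ∑b))
      b₁i : suc (b₁ i) ≡ b i
      b₁i = ≡.trans (cong suc (inc-there c (i≢j ∘ sym))) (sym (≡.trans (b≗ i) (inc-here i c)))
      no-farther : ∀ k → b₁ k ∸ b* k ≤ b k ∸ b* k
      no-farther k = case ((i ≟ k) , (j ≟ k)) of λ where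
        (yes ≡.refl , _)    → ∸-monoˡ-≤ (b* i) (≤-trans (n≤1+n _) (≤-reflexive b₁i))
        (no _ , yes ≡.refl) → ≤-trans (≤-reflexive (m≤n⇒m∸n≡0 (subst (_≤ b* j) (sym (≡.trans (inc-here j c) (cong suc cj≡bj))) bj<))) z≤n
        (no i≢k , no j≢k)   → ≤-reflexive (cong (_∸ b* k) (≡.trans (inc-there c j≢k) (dec-there b i≢k)))
      nearer : b₁ i ∸ b* i < b i ∸ b* i
      nearer = ∸-monoˡ-< (≤-reflexive b₁i) (≤-pred (≤-trans bi> (≤-reflexive (sym b₁i))))
      closer : distance b₁ < n
      closer = <-≤-trans (∑-mono-< no-farther i nearer) dist
      b≤b₁ : winning b ≤ winning b₁
      b≤b₁ = ≤-trans (≤-reflexive (winning-cong b≗)) (improve i≢j cj≤ci)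
      step : Optimum b₁ → Optimum b
      -- Either `b₁` is still unbalanced and strictness comes from a later move, or this move is
      -- strict: with `c j ≡ c i`, the vector `b` would be `b₁` with two entries exchanged, hence
      -- balanced.
      step (b₁≤ , b₁<) = ≤-trans b≤b₁ b₁≤ , λ ¬exc ¬bal → case balanced? b₁ of λ where
        (no ¬bal₁) → ≤-<-trans b≤b₁ (b₁< ¬exc ¬bal₁)
        (yes bal₁) → <-≤-trans (≤-<-trans (≤-reflexive (winning-cong b≗)) (improve-strict ¬exc i≢j
                        (≤∧≢⇒< cj≤ci λ cj≡ci → ¬bal (balanced-cong (sym ∘ b≗) (balanced-swap i≢j (sym cj≡ci) bal₁)))
                        ∑b₁ bal₁)) b₁≤

    optimum : ∀ b → ∑ b ≡ m → Optimum b
    optimum b = descend (suc (distance b)) b ≤-refl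

-- From probabilities to counts.

ratio-mono : ∀ {a b} n → a ≤ b → ratio a n ≤ℚ ratio b n
ratio-mono         zero    a≤b = ℚ.≤-refl
ratio-mono {a} {b} (suc k) a≤b = ℚ.toℚᵘ-cancel-≤ (begin
  ℚ.toℚᵘ (ratio a (suc k))  ≃⟨ ℚ.toℚᵘ-fromℚᵘ (mkℚᵘ (ℤ.+ a) k) ⟩
  mkℚᵘ (ℤ.+ a) k              ≤⟨ *≤* (ℤ.*-monoʳ-≤-nonNeg (ℤ.+ suc k) (ℤ.+≤+ a≤b)) ⟩
  mkℚᵘ (ℤ.+ b) k              ≃⟨ ℚ.toℚᵘ-fromℚᵘ (mkℚᵘ (ℤ.+ b) k) ⟨
  ℚ.toℚᵘ (ratio b (suc k))  ∎)
  where open ℚᵘ.≤-Reasoning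

ratio-cancel : ∀ {a b n} → 0 < n → ratio a n ≤ℚ ratio b n → a ≤ b
ratio-cancel {a} {b} {suc k} _ le = ℤ.drop‿+≤+ (ℤ.*-cancelʳ-≤-pos (ℤ.+ a) (ℤ.+ b) (ℤ.+ suc k) (ℚᵘ.drop-*≤* (begin
  mkℚᵘ (ℤ.+ a) k              ≃⟨ ℚ.toℚᵘ-fromℚᵘ (mkℚᵘ (ℤ.+ a) k) ⟨
  ℚ.toℚᵘ (ratio a (suc k))  ≤⟨ ℚ.toℚᵘ-mono-≤ le ⟩
  ℚ.toℚᵘ (ratio b (suc k))  ≃⟨ ℚ.toℚᵘ-fromℚᵘ (mkℚᵘ (ℤ.+ b) k) ⟩
  mkℚᵘ (ℤ.+ b) k              ∎)))
  where open ℚᵘ.≤-Reasoning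

numWinning≤numArrangements : ∀ {v} (b s : Fin v → ℕ) → numWinning b s ≤ numArrangements s
numWinning≤numArrangements {v} b s = go (words v (Σ s))
  where
  go : ∀ ws → countTrue (map (λ w → isArrangement s w ∧ avoids (bidSeq b) w) ws) ≤ countTrue (map (isArrangement s) ws)
  go []       = z≤n
  go (w ∷ ws) with isArrangement s w | avoids (bidSeq b) w
  ... | true  | true  = s≤s (go ws)
  ... | true  | false = m≤n⇒m≤1+n (go ws)
  ... | false | _     = go ws

-- Cancelling needs a positive denominator. A bid that wins somewhere provides it, since its winning
-- arrangements are arrangements; for a bid that never wins the claim is trivial.
Pr-cancel : ∀ {v} (s b c : Fin v → ℕ) → Pr b s ≤ℚ Pr c s → numWinning b s ≤ numWinning c s
Pr-cancel s b c le with numWinning b s in eq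
... | zero  = z≤n
... | suc n = ratio-cancel (<-≤-trans (s≤s z≤n) (subst (_≤ numArrangements s) eq (numWinning≤numArrangements b s))) le

Pr-mono : ∀ {v} (s b c : Fin v → ℕ) → numWinning b s ≤ numWinning c s → Pr b s ≤ℚ Pr c s
Pr-mono s b c le = ratio-mono (numArrangements s) le

numWinning-cong : ∀ {v} {b c : Fin v → ℕ} s → b ≗ c → numWinning b s ≡ numWinning c s
numWinning-cong {v} s b≗c =
  cong (λ xs → countTrue (map (λ w → isArrangement s w ∧ avoids xs w) (words v (Σ s)))) (bidSeq-cong b≗c)

-- The exceptional deck

triple : ℕ → ℕ → ℕ → Fin 3 → ℕ
triple x y z zero             = x
triple x y z (suc zero)       = y
triple x y z (suc (suc zero)) = z

triple-η : ∀ b → b ≗ triple (b zero) (b (suc zero)) (b (suc (suc zero)))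
triple-η b zero             = ≡.refl
triple-η b (suc zero)       = ≡.refl
triple-η b (suc (suc zero)) = ≡.refl

Listed : (Fin 3 → ℕ) → Set
Listed b =
  (∀ i → b i ≡ 1) ⊎
  ∃ λ (π : Permutation′ 3) →
    (b (π ⟨$⟩ʳ zero) ≡ 2) × (b (π ⟨$⟩ʳ suc zero) ≡ 1) × (b (π ⟨$⟩ʳ suc (suc zero)) ≡ 0)

listed-cong : ∀ {b c} → b ≗ c → Listed b → Listed c
listed-cong b≗c (inj₁ ones)            = inj₁ λ i → ≡.trans (sym (b≗c i)) (ones i)
listed-cong b≗c (inj₂ (π , p , q , r)) =
  inj₂ (π , ≡.trans (sym (b≗c _)) p , ≡.trans (sym (b≗c _)) q , ≡.trans (sym (b≗c _)) r)

winners : (Fin 3 → ℕ) → ℕ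
winners b = numWinning b (regular 3 1)

-- Ten triples have sum 3, and evaluation decides each. Naming one value three times always loses;
-- each of the other seven survives two of the six arrangements.
classify : ∀ x y z → Σ (triple x y z) ≡ 3 →
  (winners (triple x y z) ≡ 2 × Listed (triple x y z)) ⊎
  (winners (triple x y z) ≡ 0 × ∃ λ k → triple x y z k ≡ 3)
classify 3 0 0 ≡.refl = inj₂ (≡.refl , zero , ≡.refl)
classify 0 3 0 ≡.refl = inj₂ (≡.refl , suc zero , ≡.refl)
classify 0 0 3 ≡.refl = inj₂ (≡.refl , suc (suc zero) , ≡.refl)
classify 1 1 1 ≡.refl = inj₁ (≡.refl , inj₁ λ { zero → ≡.refl ; (suc zero) → ≡.refl ; (suc (suc zero)) → ≡.refl })
classify 2 1 0 ≡.refl = inj₁ (≡.refl , inj₂ (idₚ , ≡.refl , ≡.refl , ≡.refl))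
classify 2 0 1 ≡.refl = inj₁ (≡.refl , inj₂ (transpose (suc zero) (suc (suc zero)) , ≡.refl , ≡.refl , ≡.refl))
classify 1 2 0 ≡.refl = inj₁ (≡.refl , inj₂ (transpose zero (suc zero) , ≡.refl , ≡.refl , ≡.refl))
classify 0 1 2 ≡.refl = inj₁ (≡.refl , inj₂ (transpose zero (suc (suc zero)) , ≡.refl , ≡.refl , ≡.refl))
-- `∘ₚ` applies its left factor first; the resulting 3-cycle sends 0, 1, 2 to the positions of the
-- entries 2, 1, 0.
classify 1 0 2 ≡.refl = inj₁ (≡.refl , inj₂ (transpose zero (suc zero) ∘ₚ transpose (suc zero) (suc (suc zero)) , ≡.refl , ≡.refl , ≡.refl))
classify 0 2 1 ≡.refl = inj₁ (≡.refl , inj₂ (transpose (suc zero) (suc (suc zero)) ∘ₚ transpose zero (suc zero) , ≡.refl , ≡.refl , ≡.refl))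

classify′ : ∀ b → Σ b ≡ 3 → (winners b ≡ 2 × Listed b) ⊎ (winners b ≡ 0 × ∃ λ k → b k ≡ 3)
classify′ b Σb = Sum.map
  (λ (w , listed) → ≡.trans η w , listed-cong (sym ∘ triple-η b) listed)
  (λ (w , k , eq) → ≡.trans η w , k , ≡.trans (triple-η b k) eq)
  (classify (b zero) (b (suc zero)) (b (suc (suc zero))) Σb)
  where
  η : winners b ≡ winners (triple (b zero) (b (suc zero)) (b (suc (suc zero))))
  η = numWinning-cong (regular 3 1) (triple-η b)

listed⇒Σ≡3 : ∀ {b} → Listed b → Σ b ≡ 3
listed⇒Σ≡3 (inj₁ ones) = Σ-cong ones
listed⇒Σ≡3 {b} (inj₂ (π , p , q , r)) = begin
  Σ b                      ≡⟨ Σ≡∑ b ⟩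
  ∑ b                      ≡⟨ sum-permute b π ⟩
  ∑ (b ∘ (π ⟨$⟩ʳ_))        ≡⟨ cong₂ _+_ p (cong₂ _+_ q (cong (_+ 0) r)) ⟩
  3                        ∎
  where open ≡-Reasoning

listed-≢3 : ∀ {b} → Listed b → ∀ k → b k ≢ 3
listed-≢3 (inj₁ ones) k eq = contradiction (≡.trans (sym (ones k)) eq) λ ()
listed-≢3 {b} (inj₂ (π , p , q , r)) k eq = contradict (π ⟨$⟩ˡ k) (≡.trans (cong b (inverseʳ π)) eq)
  where
  contradict : ∀ l → b (π ⟨$⟩ʳ l) ≢ 3
  contradict zero             e = contradiction (≡.trans (sym p) e) λ ()
  contradict (suc zero)       e = contradiction (≡.trans (sym q) e) λ ()
  contradict (suc (suc zero)) e = contradiction (≡.trans (sym r) e) λ ()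

optimal⇔listed : ∀ b → Optimal (regular 3 1) 3 b ⇔ Listed b
optimal⇔listed b = mk⇔ to from
  where
  winners-111 : winners (triple 1 1 1) ≡ 2
  winners-111 = ≡.refl
  to : Optimal (regular 3 1) 3 b → Listed b
  to (Σb , opt) = case classify′ b Σb of λ where
    (inj₁ (_ , listed)) → listed
    (inj₂ (w , _))      → contradiction (subst₂ _≤_ winners-111 w (Pr-cancel (regular 3 1) (triple 1 1 1) b (opt (triple 1 1 1) ≡.refl))) λ ()
  at-most-2 : ∀ b′ → Σ b′ ≡ 3 → winners b′ ≤ 2
  at-most-2 b′ Σb′ = case classify′ b′ Σb′ of λ where
    (inj₁ (w , _)) → ≤-reflexive w
    (inj₂ (w , _)) → ≤-trans (≤-reflexive w) z≤n
  from : Listed b → Optimal (regular 3 1) 3 b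
  from listed = Σb , λ b′ Σb′ → Pr-mono (regular 3 1) b′ b (subst (winners b′ ≤_) (sym exactly-2) (at-most-2 b′ Σb′))
    where
    Σb = listed⇒Σ≡3 listed
    exactly-2 : winners b ≡ 2
    exactly-2 = case classify′ b Σb of λ where
      (inj₁ (w , _))      → w
      (inj₂ (_ , k , eq)) → contradiction eq (listed-≢3 listed k)

-- The general case.

optimal⇔almost-regular : ∀ v s m → 3 ≤ v → 1 ≤ s → m ≤ s * v → ¬ (v ≡ 3 × s ≡ 1 × m ≡ 3) → (b : Fin v → ℕ) →
  Optimal (regular v s) m b ⇔ ((Σ b ≡ m) × (∀ i → (b i ≡ floorDiv m v) ⊎ (b i ≡ ceilDiv m v)))
optimal⇔almost-regular v@(suc n) (suc t) m v≥3 _ m≤ ¬exc b = mk⇔ to from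
  where
  open Game v t m v≥3 m≤
  open Rounding n m using (balanced⇒rounded; rounded⇒balanced)
  to : Optimal deck m b → Σ b ≡ m × (∀ i → b i ≡ floorDiv m v ⊎ b i ≡ ceilDiv m v)
  to (Σb , opt) = Σb , balanced⇒rounded ∑b (decidable-stable (balanced? b) not-unbalanced)
    where
    ∑b : ∑ b ≡ m
    ∑b = ≡.trans (sym (Σ≡∑ b)) Σb
    not-unbalanced : ¬ ¬ Balanced b
    -- An unbalanced vector is strictly beaten by any balanced one, against its optimality.
    not-unbalanced ¬bal = case balanced-exists v m of λ (b* , ∑b* , bal*) →
      <⇒≱ (subst₂ _<_ (sym (numWinning≡winning b ∑b)) (sym (numWinning≡winning b* ∑b*))
            (proj₂ (Target.optimum b* ∑b* bal* b ∑b) ¬exc ¬bal))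
          (Pr-cancel deck b* b (opt b* (≡.trans (Σ≡∑ b*) ∑b*)))
  from : Σ b ≡ m × (∀ i → b i ≡ floorDiv m v ⊎ b i ≡ ceilDiv m v) → Optimal deck m b
  from (Σb , rounded) = Σb , λ b′ Σb′ → Pr-mono deck b′ b
      (subst₂ _≤_ (sym (numWinning≡winning b′ (≡.trans (sym (Σ≡∑ b′)) Σb′))) (sym (numWinning≡winning b ∑b))
        -- Here `b` itself serves as the balanced target that every competitor descends to.
        (proj₁ (Target.optimum b ∑b (rounded⇒balanced rounded) b′ (≡.trans (sym (Σ≡∑ b′)) Σb′))))
    where
    ∑b : ∑ b ≡ m
    ∑b = ≡.trans (sym (Σ≡∑ b)) Σb

theorem1p5 : ((b : Fin 3 → ℕ) →
    Optimal (regular 3 1) 3 b ⇔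
    ((∀ i → b i ≡ 1) ⊎
    ∃ λ (π : Permutation′ 3) →
    (b (π ⟨$⟩ʳ zero) ≡ 2) × (b (π ⟨$⟩ʳ suc zero) ≡ 1) × (b (π ⟨$⟩ʳ suc (suc zero)) ≡ 0)))
    ×
    ((v s m : ℕ) → 3 ≤ v → 1 ≤ s → m ≤ s * v →
    ¬ ((v ≡ 3) × (s ≡ 1) × (m ≡ 3)) →
    (b : Fin v → ℕ) →
    Optimal (regular v s) m b ⇔
    ((Σ b ≡ m) × (∀ i → (b i ≡ floorDiv m v) ⊎ (b i ≡ ceilDiv m v))))
theorem1p5 = optimal⇔listed , optimal⇔almost-regular
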